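{- Let $C_n(a,b)$ be a connected $2$-regular circulant digraph (so $\gcd(n,a,b)=1$) and let $l\ge1$. Then the number of primitive periodic orbits of length $l$ is $$|\mathcal{P}_l(C_n(a,b))|=\frac{n}{l}\sum_{\omega=\lceil la/n\rceil}^{\lfloor lb/n\rfloor}\ \sum_{m\mid\omega}\mu(m)\binom{l/m}{k_\omega/m},$$ where $k_\omega=(\omega n-la)/(b-a)$, $\mu$ is the Möbius function, and $\binom{x}{y}$ is interpreted as $0$ unless both $x$ and $y$ are nonnegative integers.
   Context: Let $n\ge 2$ and $0<a<b<n$ be integers. The directed circulant graph $C_n(a,b)$ has vertex set $\mathbb{Z}_n$ and directed bonds $(v,v+a)$ and $(v,v+b)$ for each $v\in\mathbb{Z}_n$ (addition mod $n$); the bond $(v,v+s)$ has step size $s\in\{a,b\}$. It is (strongly) connected iff $\gcd(n,a,b)=1$. A path of length $l$ is a sequence of bonds $(e_1,\dots,e_l)$ where the terminus of $e_j$ is the origin of $e_{j+1}$. A circuit is a path whose last terminus equals its first origin. A periodic orbit is an equivalence class of circuits under cyclic rotation $\sigma(e_1,\dots,e_l)=(e_2,\dots,e_l,e_1)$. For a circuit $c$, $c^r$ denotes the concatenation of $r$ copies of $c$. A periodic orbit $p$ is primitive if there is no circuit $c_0$ and integer $r>1$ with $p=[c_0^r]$. $\mathcal{P}_l(C_n(a,b))$ denotes the set of primitive periodic orbits of length $l$. -}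

module Defs where

open import Data.Bool.Base using (if_then_else_)
open import Data.Fin.Base using (Fin; toℕ)
open import Data.Integer.Base as ℤ using (ℤ; +_; -[1+_]; 0ℤ; 1ℤ; -1ℤ; ∣_∣)
open import Data.List.Base using (List; []; _∷_; _++_; [_]; map; foldr; filter; upTo; concat; replicate; length; head; last)
open import Data.List.Relation.Unary.All using (All)
open import Data.List.Relation.Unary.Linked using (Linked)
open import Data.Maybe.Base as Maybe using (Maybe)
open import Data.Nat.Base as ℕ using (ℕ; zero; suc; NonZero; _<_)
open import Data.Nat.Combinatorics using (_C_)
open import Data.Nat.Divisibility using (_∣?_)
open import Data.Nat.DivMod using (_mod_)
open import Data.Nat.Primality.Factorisation using (factorise; factors)
open import Data.Nat.Properties using (≡-decSetoid; m<n⇒0<n∸m)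
open import Data.List.Relation.Unary.Unique.DecSetoid ≡-decSetoid using (unique?)
open import Data.Product.Base using (_×_; _,_; proj₁; proj₂; ∃-syntax)
open import Data.Rational.Base as ℚ using (ℚ; mkℚ; _/_)
open import Data.Sum.Base using (_⊎_)
open import Function.Bundles using (Bijection)
open import Level using (0ℓ)
open import Relation.Binary.Bundles using (Setoid)
open import Relation.Binary.Construct.Closure.Equivalence using (EqClosure)
import Relation.Binary.Construct.Closure.Equivalence as EqClosure
open import Relation.Binary.Construct.Closure.ReflexiveTransitive using (Star)
import Relation.Binary.Construct.On as On
open import Relation.Binary.PropositionalEquality using (_≡_; setoid)
open import Relation.Nullary using (¬_; does)

HasCardinality : Setoid 0ℓ 0ℓ → ℕ → Set
HasCardinality S N = Bijection S (setoid (Fin N))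

-- ℤₙ is represented by Fin n.
module Circulant (n a b : ℕ) .{{_ : NonZero n}} where

  Vertex : Set
  Vertex = Fin n

  _⊕_ : Vertex → ℕ → Vertex
  v ⊕ s = (toℕ v ℕ.+ s) mod n

  _⟶_ : Vertex → Vertex → Set
  v ⟶ w = w ≡ v ⊕ a ⊎ w ≡ v ⊕ b

  Connected : Set
  Connected = ∀ u v → Star _⟶_ u v

  VertexPair : Set
  VertexPair = Vertex × Vertex

  origin terminus : VertexPair → Vertex
  origin   = proj₁
  terminus = proj₂

  IsBond : VertexPair → Set
  IsBond e = origin e ⟶ terminus e

  IsPath : List VertexPair → Set
  IsPath es = All IsBond es × Linked (λ e f → terminus e ≡ origin f) es

  -- The empty list counts as a circuit.  This does not affect primitivity
  -- of nonempty circuits, as all powers of the empty list are empty.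
  IsCircuit : List VertexPair → Set
  IsCircuit es = IsPath es × Maybe.map terminus (last es) ≡ Maybe.map origin (head es)

  σ : List VertexPair → List VertexPair
  σ []       = []
  σ (e ∷ es) = es ++ [ e ]

  _↻_ : List VertexPair → List VertexPair → Set
  c ↻ c′ = σ c ≡ c′

  _≈_ : List VertexPair → List VertexPair → Set
  _≈_ = EqClosure _↻_

  _^_ : List VertexPair → ℕ → List VertexPair
  c ^ r = concat (replicate r c)

  IsPrimitive : List VertexPair → Set
  IsPrimitive c = ¬ (∃[ c₀ ] ∃[ r ] IsCircuit c₀ × 1 < r × c ≈ (c₀ ^ r))

  record PrimitiveCircuit (l : ℕ) : Set where
    field
      bonds       : List VertexPair
      length≡     : length bonds ≡ l
      isCircuit   : IsCircuit bonds
      isPrimitive : IsPrimitive bonds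

  -- An orbit is a circuit up to _≈_; the proof fields are not compared.
  PrimitiveOrbits : ℕ → Setoid 0ℓ 0ℓ
  PrimitiveOrbits l = On.setoid (EqClosure.setoid _↻_) (PrimitiveCircuit.bonds {l})

open Circulant public using (Connected; PrimitiveOrbits)

-- factors lists prime factors with multiplicity, so it is free of
-- repetitions exactly when m is squarefree.
μ : (m : ℕ) .{{_ : NonZero m}} → ℤ
μ m = if does (unique? ps) then -1ℤ ℤ.^ length ps else 0ℤ
  where ps = factors (factorise m)

-- The second field of mkℚ is the predecessor of the denominator in lowest
-- terms, so the first clause is the case of two nonnegative integers.
binomial : ℚ → ℚ → ℕ
binomial (mkℚ (+ x) zero _) (mkℚ (+ y) zero _) = x C y
binomial _                  _                  = 0

_÷_ : ℚ → (m : ℕ) .{{_ : NonZero m}} → ℚ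
q ÷ m = q ℚ.* (1ℤ / m)

kω : (n a b l : ℕ) → a < b → ℤ → ℚ
kω n a b l a<b ω = (ω ℤ.* + n ℤ.- + l ℤ.* + a) / (b ℕ.∸ a)
  where instance _ = ℕ.>-nonZero (m<n⇒0<n∸m a<b)

sumℤ : List ℤ → ℤ
sumℤ = foldr ℤ._+_ 0ℤ

-- The integers i with p ≤ i ≤ q.
interval : ℤ → ℤ → List ℤ
interval p q = map (λ i → p ℤ.+ + i) (upTo (size (ℤ.suc q ℤ.- p)))
  where
  size : ℤ → ℕ
  size (+ k)    = k
  size -[1+ _ ] = 0

∑-interval : ℤ → ℤ → (ℤ → ℤ) → ℤ
∑-interval p q f = sumℤ (map f (interval p q))

syntax ∑-interval p q (λ ω → t) = ∑[ ω from p to q ] t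

-- Sum over the positive divisors of ω, for ω ≢ 0.  Divisors are written
-- suc i with i < ∣ ω ∣, which supplies their NonZero instances.
∑-divisors : ℤ → ((m : ℕ) .{{_ : NonZero m}} → ℤ) → ℤ
∑-divisors ω f = sumℤ (map (λ i → f (suc i)) (filter (λ i → suc i ∣? ∣ ω ∣) (upTo ∣ ω ∣)))

-- Call c = u^m an m-th power.  The m for which a circuit c is an m-th power are
-- the divisors of one number, its exponent, and c is primitive exactly when its
-- exponent is 1, so Σ_{m ∣ exponent c} μ(m) detects primitivity.  If c winds ω
-- times around ℤₙ and c = u^m then u is again a circuit, winding ω/m times, so
-- the exponent divides ω.  Exchanging the sums, each m ∣ ω contributes μ(m) times
-- the number of circuits of length l/m and winding ω/m: a starting vertex and a
-- word with k_ω/m letters b among l/m.  A primitive orbit of length l consists of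
-- l distinct circuits, whence the factor n/l.
module Submission where

open import Defs
open import Data.Bool.Base using (Bool; true; false; if_then_else_)
open import Data.Fin.Base using (Fin; zero; suc; toℕ)
import Data.Fin.Properties as Finₚ
open import Data.Integer.Base as ℤ using (ℤ; +_; -[1+_]; 0ℤ; 1ℤ; -1ℤ)
import Data.Integer.DivMod as ℤ
import Data.Integer.Properties as ℤₚ
open import Data.List.Base using (List; []; _∷_; _++_; [_]; map; filter; length; concat; replicate; take; drop; last; upTo; applyUpTo; allFin; cartesianProductWith; deduplicate; lookup)
open import Data.List.Membership.Propositional using (_∈_; _∉_)
open import Data.List.Membership.Propositional.Properties
open import Data.List.Membership.Propositional.Properties.WithK using (unique∧set⇒bag)
import Data.List.Properties as Listₚ
open import Data.List.Relation.Binary.BagAndSetEquality using (∼bag⇒↭)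
open import Data.List.Relation.Binary.Disjoint.Propositional using (Disjoint)
open import Data.List.Relation.Binary.Permutation.Propositional as ↭ using (_↭_; ↭-sym; ↭⇒↭ₛ)
open import Data.List.Relation.Binary.Permutation.Propositional.Properties using (↭-length)
import Data.List.Relation.Binary.Permutation.Setoid.Properties as ↭ₛ
open import Data.List.Relation.Unary.All as All using (All; []; _∷_)
import Data.List.Relation.Unary.All.Properties as Allₚ
open import Data.List.Relation.Unary.AllPairs as AllPairs using (AllPairs; []; _∷_)
import Data.List.Relation.Unary.AllPairs.Properties as AllPairsₚ
open import Data.List.Relation.Unary.Any as Any using (Any; here; there)
import Data.List.Relation.Unary.Any.Properties as Anyₚ
open import Data.List.Relation.Unary.Linked using (Linked; []; [-]; _∷_)
open import Data.List.Relation.Unary.Unique.DecSetoid.Properties using (deduplicate-!)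
open import Data.List.Relation.Unary.Unique.Propositional using (Unique)
import Data.List.Relation.Unary.Unique.Propositional.Properties as Unique
open import Data.Maybe.Base as Maybe using (just)
open import Data.Maybe.Properties using (just-injective)
open import Data.Nat.Base as ℕ using (ℕ; zero; suc; NonZero; _≤_; _<_; _∸_; z<s)
open import Data.Nat.Combinatorics using (_C_; nCk+nC[k+1]≡[n+1]C[k+1])
import Data.Nat.Coprimality as Coprimality
open import Data.Nat.Divisibility
open import Data.Nat.DivMod using (_%_; m%n<n; m%n%n≡m%n; m<n⇒m%n≡m; m≡m%n+[m/n]*n; %-distribˡ-+; %-remove-+ʳ)
open import Data.Nat.Induction using (<-rec)
open import Data.Nat.ListAction using (product)
open import Data.Nat.ListAction.Properties using (∈⇒∣product)
open import Data.Nat.Primality using (Prime; euclidsLemma; prime⇒nonZero)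
open import Data.Nat.Primality.Factorisation
import Data.Nat.Properties as ℕₚ
import Algebra.Properties.AbelianGroup ℤₚ.+-0-abelianGroup as ℤ+ᵍ
import Algebra.Properties.CommutativeSemigroup ℤₚ.+-commutativeSemigroup as ℤ+
import Algebra.Properties.CommutativeSemigroup ℤₚ.*-commutativeSemigroup as ℤ*
import Algebra.Properties.CommutativeSemigroup ℕₚ.+-commutativeSemigroup as ℕ+
import Algebra.Properties.CommutativeSemigroup ℕₚ.*-commutativeSemigroup as ℕ*
open import Data.List.Relation.Unary.Unique.DecSetoid ℕₚ.≡-decSetoid using (unique?)
open import Data.Product.Base using (_×_; _,_; proj₁; proj₂; ∃-syntax)
open import Data.Product.Properties using (≡-dec; ,-injectiveˡ; ,-injectiveʳ)
open import Data.Rational.Base as ℚ using (ℚ; mkℚ; _/_; floor; ceiling; ↥_; ↧_; toℚᵘ)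
import Data.Rational.Properties as ℚₚ
open import Data.Rational.Unnormalised.Base as ℚᵘ using (mkℚᵘ; *≡*)
import Data.Rational.Unnormalised.Properties as ℚᵘₚ
open import Data.Sum.Base using (inj₁; inj₂)
open import Function.Base using (_∘_; it)
open import Function.Bundles using (mk⇔)
open import Level using (0ℓ)
open import Relation.Binary.Bundles using (DecSetoid)
import Relation.Binary.Construct.Closure.Equivalence as EqClosure
open import Relation.Binary.Definitions using (DecidableEquality)
open import Relation.Binary.PropositionalEquality using (_≡_; _≢_; refl; sym; trans; cong; cong₂; subst; subst₂; setoid; module ≡-Reasoning)
open import Relation.Binary.Structures using (IsEquivalence)
open import Relation.Nullary using (¬_; Dec; yes; no; does; contradiction; ¬?)
open import Relation.Nullary.Decidable using (dec-true; dec-false; _×-dec_)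
open import Relation.Unary using (Decidable)
open PrimeFactorisation using (isFactorisation; factorsPrime)

-- Finite sums

-- The exponent comes from periods, not from roots. For `xs` of length `m * d`, being an `m`-th
-- power amounts to being fixed by rotation through `d`. The rotations fixing `xs` are closed under
-- subtraction, hence are the multiples of a least one, and the exponent is the length divided by
-- it. A list and its rotations have the same periods, so the exponent is constant on orbits; this
-- matters because primitivity excludes every rotation of a power. Circuits are coded by a start
-- vertex and a Boolean word. The code is faithful because `0 < b - a < n` keeps the two steps
-- distinct mod `n`. Steps are added up in ℕ, so that the winding `ω` is an exact quotient by `n`;
-- from `l * a ≤ ω * n ≤ l * b` it lies in the range of summation, and it is positive since `l * a`
-- is. Where `l / m` or `k_ω / m` is not a natural number the binomial is 0 by convention. This is
-- the true count: an `m`-th root would have `l / m` bonds, `k_ω / m` of them of step `b`.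

private variable
  A B : Set

-- Enumerations are compared through this lemma: two repetition-free lists with the same members,
-- with no explicit bijection of positions.
unique∧⊆⊇⇒↭ : {xs ys : List A} → Unique xs → Unique ys →
  (∀ {x} → x ∈ xs → x ∈ ys) → (∀ {x} → x ∈ ys → x ∈ xs) → xs ↭ ys
unique∧⊆⊇⇒↭ xs! ys! f g = ∼bag⇒↭ (unique∧set⇒bag xs! ys! (mk⇔ f g))

∑ : (A → ℤ) → List A → ℤ
∑ f xs = sumℤ (map f xs)

∑-cong : {f g : A → ℤ} (xs : List A) → (∀ {x} → x ∈ xs → f x ≡ g x) → ∑ f xs ≡ ∑ g xs
∑-cong []       eq = refl
∑-cong (x ∷ xs) eq = cong₂ ℤ._+_ (eq (here refl)) (∑-cong xs (eq ∘ there))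

∑-map : (f : B → ℤ) (h : A → B) (xs : List A) → ∑ f (map h xs) ≡ ∑ (f ∘ h) xs
∑-map f h []       = refl
∑-map f h (x ∷ xs) = cong (ℤ._+_ (f (h x))) (∑-map f h xs)

∑-++ : (f : A → ℤ) (xs ys : List A) → ∑ f (xs ++ ys) ≡ ∑ f xs ℤ.+ ∑ f ys
∑-++ f []       ys = sym (ℤₚ.+-identityˡ _)
∑-++ f (x ∷ xs) ys = trans (cong (ℤ._+_ (f x)) (∑-++ f xs ys)) (sym (ℤₚ.+-assoc (f x) _ _))

∑-concat : (f : A → ℤ) (xss : List (List A)) → ∑ f (concat xss) ≡ ∑ (∑ f) xss
∑-concat f []         = refl
∑-concat f (xs ∷ xss) = trans (∑-++ f xs (concat xss)) (cong (ℤ._+_ (∑ f xs)) (∑-concat f xss))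

∑-↭ : (f : A → ℤ) {xs ys : List A} → xs ↭ ys → ∑ f xs ≡ ∑ f ys
∑-↭ f ↭.refl          = refl
∑-↭ f (↭.prep x p)    = cong (ℤ._+_ (f x)) (∑-↭ f p)
∑-↭ f (↭.swap x y p)  = trans (ℤ+.x∙yz≈y∙xz (f x) (f y) _) (cong (λ s → f y ℤ.+ (f x ℤ.+ s)) (∑-↭ f p))
∑-↭ f (↭.trans p q)   = trans (∑-↭ f p) (∑-↭ f q)

∑-zero : (xs : List A) → ∑ (λ _ → 0ℤ) xs ≡ 0ℤ
∑-zero []       = refl
∑-zero (x ∷ xs) = trans (ℤₚ.+-identityˡ _) (∑-zero xs)

∑-+ : (f g : A → ℤ) (xs : List A) → ∑ (λ x → f x ℤ.+ g x) xs ≡ ∑ f xs ℤ.+ ∑ g xs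
∑-+ f g []       = refl
∑-+ f g (x ∷ xs) = trans (cong (ℤ._+_ (f x ℤ.+ g x)) (∑-+ f g xs)) (ℤ+.interchange (f x) (g x) _ _)

∑-*ˡ : (k : ℤ) (f : A → ℤ) (xs : List A) → ∑ (λ x → k ℤ.* f x) xs ≡ k ℤ.* ∑ f xs
∑-*ˡ k f []       = sym (ℤₚ.*-zeroʳ k)
∑-*ˡ k f (x ∷ xs) = trans (cong (ℤ._+_ (k ℤ.* f x)) (∑-*ˡ k f xs)) (sym (ℤₚ.*-distribˡ-+ k (f x) _))

∑-swap : (f : A → B → ℤ) (xs : List A) (ys : List B) →
  ∑ (λ x → ∑ (f x) ys) xs ≡ ∑ (λ y → ∑ (λ x → f x y) xs) ys
∑-swap f []       ys = sym (∑-zero ys)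
∑-swap f (x ∷ xs) ys = trans (cong (ℤ._+_ (∑ (f x) ys)) (∑-swap f xs ys))
                             (sym (∑-+ (f x) (λ y → ∑ (λ x′ → f x′ y) xs) ys))

𝟙 : {P : Set} → Dec P → ℤ
𝟙 (yes _) = 1ℤ
𝟙 (no _)  = 0ℤ

module _ {P : A → Set} (P? : Decidable P) where

  ∑-filter : (f : A → ℤ) (xs : List A) → ∑ f (filter P? xs) ≡ ∑ (λ x → f x ℤ.* 𝟙 (P? x)) xs
  ∑-filter f []       = refl
  ∑-filter f (x ∷ xs) with P? x
  ... | yes _ = cong₂ ℤ._+_ (sym (ℤₚ.*-identityʳ (f x))) (∑-filter f xs)
  ... | no _  = trans (∑-filter f xs) (sym (trans (cong (ℤ._+ rest) (ℤₚ.*-zeroʳ (f x))) (ℤₚ.+-identityˡ rest)))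
    where rest = ∑ (λ x → f x ℤ.* 𝟙 (P? x)) xs

  ∑-𝟙 : (xs : List A) → ∑ (λ x → 𝟙 (P? x)) xs ≡ + length (filter P? xs)
  ∑-𝟙 []       = refl
  ∑-𝟙 (x ∷ xs) with P? x
  ... | yes _ = cong (ℤ._+_ 1ℤ) (∑-𝟙 xs)
  ... | no _  = trans (ℤₚ.+-identityˡ _) (∑-𝟙 xs)

𝟙-yes : {P : Set} (P? : Dec P) → P → 𝟙 P? ≡ 1ℤ
𝟙-yes (yes _) p = refl
𝟙-yes (no ¬p) p = contradiction p ¬p

𝟙-no : {P : Set} (P? : Dec P) → ¬ P → 𝟙 P? ≡ 0ℤ
𝟙-no (yes p) ¬p = contradiction p ¬p
𝟙-no (no _)  ¬p = refl

𝟙-cong : {P Q : Set} (P? : Dec P) (Q? : Dec Q) → (P → Q) → (Q → P) → 𝟙 P? ≡ 𝟙 Q?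
𝟙-cong P? (yes q) f g = 𝟙-yes P? (g q)
𝟙-cong P? (no ¬q) f g = 𝟙-no P? (¬q ∘ f)

module _ {A B : Set} {f : A → B} where

  unique-map : {xs : List A} → (∀ {x y} → x ∈ xs → y ∈ xs → f x ≡ f y → x ≡ y) → Unique xs → Unique (map f xs)
  unique-map inj []          = []
  unique-map inj (x∉ ∷ xs!) =
    Allₚ.map⁺ (All.tabulate λ y∈ fx≡fy → All.lookup x∉ y∈ (inj (here refl) (there y∈) fx≡fy)) ∷
    unique-map (λ x∈ y∈ → inj (there x∈) (there y∈)) xs!

module _ {A B C : Set} (f : A → B → C) where

  -- Injectivity is asked only for second arguments from `ys`, because `path v w` forgets `v` when
  -- `w` is empty.
  unique-cartesianProductWith : {xs : List A} {ys : List B} →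
    (∀ {w x y z} → y ∈ ys → z ∈ ys → f w y ≡ f x z → w ≡ x × y ≡ z) →
    Unique xs → Unique ys → Unique (cartesianProductWith f xs ys)
  unique-cartesianProductWith inj [] ys! = []
  unique-cartesianProductWith {x ∷ xs} {ys} inj (x∉ ∷ xs!) ys! = Unique.++⁺
    (unique-map (λ y∈ z∈ → proj₂ ∘ inj y∈ z∈) ys!)
    (unique-cartesianProductWith inj xs! ys!)
    λ (v∈ , v∈′) → let y , y∈ , v≡ = ∈-map⁻ (f x) v∈
                       x′ , z , x′∈ , z∈ , v≡′ = ∈-cartesianProductWith⁻ f xs ys v∈′
                   in All.lookup x∉ x′∈ (proj₁ (inj y∈ z∈ (trans (sym v≡) v≡′)))

  length-cartesianProductWith : (xs : List A) (ys : List B) →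
    length (cartesianProductWith f xs ys) ≡ length xs ℕ.* length ys
  length-cartesianProductWith []       ys = refl
  length-cartesianProductWith (x ∷ xs) ys = trans (Listₚ.length-++ (map (f x) ys))
    (cong₂ ℕ._+_ (Listₚ.length-map (f x) ys) (length-cartesianProductWith xs ys))

length≡0 : {A : Set} (xs : List A) → (∀ {x} → ¬ x ∈ xs) → length xs ≡ 0
length≡0 []       ¬∈ = refl
length≡0 (x ∷ xs) ¬∈ = contradiction (here refl) ¬∈

length-concat-map : {A B : Set} (f : A → List B) (k : ℕ) → (∀ x → length (f x) ≡ k) →
  (xs : List A) → length (concat (map f xs)) ≡ length xs ℕ.* k
length-concat-map f k eq []       = refl
length-concat-map f k eq (x ∷ xs) = trans (Listₚ.length-++ (f x)) (cong₂ ℕ._+_ (eq x) (length-concat-map f k eq xs))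

-- The Möbius function


-- `μ m` unfolds to `signed (factors (factorise m))`; as a function of lists it can be computed from
-- any permutation of the factors.
signed : List ℕ → ℤ
signed ps = if does (unique? ps) then -1ℤ ℤ.^ length ps else 0ℤ

Unique-resp-↭ : {ps qs : List ℕ} → ps ↭ qs → Unique ps → Unique qs
Unique-resp-↭ p = ↭ₛ.Unique-resp-↭ (setoid ℕ) (↭⇒↭ₛ p)

signed-unique : (ps : List ℕ) → Unique ps → signed ps ≡ -1ℤ ℤ.^ length ps
signed-unique ps ps! rewrite dec-true (unique? ps) ps! = refl

signed-¬unique : (ps : List ℕ) → ¬ Unique ps → signed ps ≡ 0ℤ
signed-¬unique ps ¬ps! rewrite dec-false (unique? ps) ¬ps! = refl

signed-↭ : {ps qs : List ℕ} → ps ↭ qs → signed ps ≡ signed qs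
signed-↭ {ps} {qs} p with unique? qs
... | yes qs! = trans (signed-unique ps (Unique-resp-↭ (↭-sym p) qs!)) (cong (-1ℤ ℤ.^_) (↭-length p))
... | no ¬qs! = signed-¬unique ps (¬qs! ∘ Unique-resp-↭ p)

module _ {p : ℕ} (p-prime : Prime p) where

  -- Unique factorisation, as `p` followed by the factors of `m` also factorises `n`. The product is
  -- a variable `n` with an equation so that it can be a successor such as `suc (scale i)`.
  factors-* : (m n : ℕ) .{{_ : NonZero m}} .{{_ : NonZero n}} → n ≡ p ℕ.* m →
    factors (factorise n) ↭ p ∷ factors (factorise m)
  factors-* m n n≡pm = factorisationUnique (factorise n) (record
    { factors         = p ∷ factors (factorise m)
    ; isFactorisation = trans n≡pm (cong (p ℕ.*_) (isFactorisation (factorise m)))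
    ; factorsPrime    = p-prime ∷ factorsPrime (factorise m)
    })

  p∣m⇒μ[pm]≡0 : (m n : ℕ) .{{_ : NonZero m}} .{{_ : NonZero n}} → n ≡ p ℕ.* m → p ∣ m → μ n ≡ 0ℤ
  p∣m⇒μ[pm]≡0 m n n≡pm p∣m = trans (signed-↭ (factors-* m n n≡pm)) (signed-¬unique (p ∷ factors (factorise m)) λ where
    (p∉ ∷ _) → Allₚ.All¬⇒¬Any p∉ (factorisationHasAllPrimeFactors p-prime
                 (subst (p ∣_) (isFactorisation (factorise m)) p∣m) (factorsPrime (factorise m))))

  p∤m⇒μ[pm]≡-μ[m] : (m n : ℕ) .{{_ : NonZero m}} .{{_ : NonZero n}} → n ≡ p ℕ.* m → p ∤ m → μ n ≡ ℤ.- μ m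
  p∤m⇒μ[pm]≡-μ[m] m n n≡pm p∤m = trans (signed-↭ (factors-* m n n≡pm)) (step (unique? ps))
    where
    ps = factors (factorise m)
    p∉ps : p ∉ ps
    p∉ps p∈ps = p∤m (subst (p ∣_) (sym (isFactorisation (factorise m))) (∈⇒∣product p∈ps))
    step : Dec (Unique ps) → signed (p ∷ ps) ≡ ℤ.- signed ps
    step (yes ps!) = begin
      signed (p ∷ ps)                    ≡⟨ signed-unique (p ∷ ps) (Allₚ.¬Any⇒All¬ ps p∉ps ∷ ps!) ⟩
      -1ℤ ℤ.* (-1ℤ ℤ.^ length ps)        ≡⟨ ℤₚ.-1*i≡-i _ ⟩
      ℤ.- (-1ℤ ℤ.^ length ps)            ≡⟨ cong ℤ.-_ (signed-unique ps ps!) ⟨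
      ℤ.- signed ps                      ∎
      where open ≡-Reasoning
    step (no ¬ps!) = trans (signed-¬unique (p ∷ ps) λ { (_ ∷ ps!) → ¬ps! ps! }) (cong ℤ.-_ (sym (signed-¬unique ps ¬ps!)))

-- The list inside `∑-divisors`, in the same encoding: `i` stands for the divisor `suc i`.
divisors : ℕ → List ℕ
divisors g = filter (λ i → suc i ∣? g) (upTo g)

divisors! : (g : ℕ) → Unique (divisors g)
divisors! g = Unique.filter⁺ (λ i → suc i ∣? g) (Unique.upTo⁺ g)

module _ (g : ℕ) .{{_ : NonZero g}} where

  ∈-divisors⁺ : ∀ {i} → suc i ∣ g → i ∈ divisors g
  ∈-divisors⁺ si∣g = ∈-filter⁺ (λ i → suc i ∣? g) (∈-upTo⁺ (∣⇒≤ si∣g)) si∣g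

  ∈-divisors⁻ : ∀ {i} → i ∈ divisors g → suc i ∣ g
  ∈-divisors⁻ i∈ = proj₂ (∈-filter⁻ (λ i → suc i ∣? g) {xs = upTo g} i∈)

∃-prime-divisor : (g : ℕ) .{{_ : NonZero g}} → g ≢ 1 → ∃[ p ] Prime p × p ∣ g
∃-prime-divisor g g≢1 with factorise g
... | record { factors = [] ; isFactorisation = g≡1 } = contradiction g≡1 g≢1
... | record { factors = p ∷ ps ; isFactorisation = g≡ ; factorsPrime = p-prime ∷ _ } =
  p , p-prime , subst (p ∣_) (sym g≡) (m∣m*n (product ps))

μ⁺ : ℕ → ℤ
μ⁺ i = μ (suc i)

-- The divisors of g = p h prime to p are those of h prime to p, and p times
-- such a divisor has the opposite μ, so the two kinds of squarefree divisors cancel.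
∑-μ-divisors-* : (h p : ℕ) .{{_ : NonZero h}} → Prime p → ∑ μ⁺ (divisors (h ℕ.* p)) ≡ 0ℤ
∑-μ-divisors-* h p p-prime = begin
    ∑ μ⁺ (divisors g)                                        ≡⟨ ∑-cong (divisors g) (λ {i} _ → split i) ⟩
    ∑ (λ i → μ⁺ i ℤ.* 𝟙 (¬? (div? i)) ℤ.+ μ⁺ i ℤ.* 𝟙 (div? i)) (divisors g)
                                                             ≡⟨ ∑-+ _ _ (divisors g) ⟩
    ∑ (λ i → μ⁺ i ℤ.* 𝟙 (¬? (div? i))) (divisors g) ℤ.+ ∑ (λ i → μ⁺ i ℤ.* 𝟙 (div? i)) (divisors g)
                                                             ≡⟨ cong₂ ℤ._+_ (∑-filter (¬? ∘ div?) μ⁺ (divisors g)) (∑-filter div? μ⁺ (divisors g)) ⟨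
    ∑ μ⁺ (filter (¬? ∘ div?) (divisors g)) ℤ.+ ∑ μ⁺ (filter div? (divisors g))
                                                             ≡⟨ cong₂ ℤ._+_ (∑-↭ μ⁺ prime-to-p) (∑-↭ μ⁺ multiples) ⟩
    ∑ μ⁺ (filter (¬? ∘ div?) (divisors h)) ℤ.+ ∑ μ⁺ (map scale (divisors h))
                                                             ≡⟨ cong (ℤ._+_ S) opposite ⟩
    S ℤ.+ (-1ℤ ℤ.* S)                                        ≡⟨ cong (ℤ._+_ S) (ℤₚ.-1*i≡-i S) ⟩
    S ℤ.- S                                                  ≡⟨ ℤₚ.+-inverseʳ S ⟩
    0ℤ                                                       ∎
  where
  open ≡-Reasoning
  g = h ℕ.* p
  instance
    p≢0 : NonZero p
    p≢0 = prime⇒nonZero p-prime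
    g≢0 : NonZero g
    g≢0 = ℕₚ.m*n≢0 h p
  div? : (i : ℕ) → Dec (p ∣ suc i)
  div? i = p ∣? suc i
  S = ∑ μ⁺ (filter (¬? ∘ div?) (divisors h))

  split : ∀ i → μ⁺ i ≡ μ⁺ i ℤ.* 𝟙 (¬? (div? i)) ℤ.+ μ⁺ i ℤ.* 𝟙 (div? i)
  split i with div? i
  ... | yes _ = sym (trans (cong₂ ℤ._+_ (ℤₚ.*-zeroʳ (μ⁺ i)) (ℤₚ.*-identityʳ (μ⁺ i))) (ℤₚ.+-identityˡ _))
  ... | no _  = sym (trans (cong₂ ℤ._+_ (ℤₚ.*-identityʳ (μ⁺ i)) (ℤₚ.*-zeroʳ (μ⁺ i))) (ℤₚ.+-identityʳ _))

  -- Multiplication by `p`, transported to the encoding in which `i` stands for `suc i`.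
  scale : ℕ → ℕ
  scale i = ℕ.pred (p ℕ.* suc i)

  suc-scale : ∀ i → suc (scale i) ≡ p ℕ.* suc i
  suc-scale i = ℕₚ.suc-pred (p ℕ.* suc i) {{ℕₚ.m*n≢0 p (suc i)}}

  scale-injective : ∀ {i j} → scale i ≡ scale j → i ≡ j
  scale-injective {i} {j} eq = ℕₚ.suc-injective (ℕₚ.*-cancelˡ-≡ (suc i) (suc j) p
    (trans (sym (suc-scale i)) (trans (cong suc eq) (suc-scale j))))

  prime-to-p : filter (¬? ∘ div?) (divisors g) ↭ filter (¬? ∘ div?) (divisors h)
  prime-to-p = unique∧⊆⊇⇒↭ (Unique.filter⁺ _ (divisors! g)) (Unique.filter⁺ _ (divisors! h))
    (λ i∈ → let i∈g , p∤i = ∈-filter⁻ (¬? ∘ div?) {xs = divisors g} i∈ in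
            ∈-filter⁺ (¬? ∘ div?) (∈-divisors⁺ h (coprime-divisor (∈-divisors⁻ g i∈g) p∤i)) p∤i)
    (λ i∈ → let i∈h , p∤i = ∈-filter⁻ (¬? ∘ div?) {xs = divisors h} i∈ in
            ∈-filter⁺ (¬? ∘ div?) (∈-divisors⁺ g (∣m⇒∣m*n p (∈-divisors⁻ h i∈h))) p∤i)
    where
    coprime-divisor : ∀ {m} .{{_ : NonZero m}} → m ∣ g → p ∤ m → m ∣ h
    coprime-divisor {m} (divides q hp≡qm) p∤m with euclidsLemma q m p-prime (divides h (sym hp≡qm))
    ... | inj₂ p∣m            = contradiction p∣m p∤m
    ... | inj₁ (divides r q≡rp) = divides r (ℕₚ.*-cancelʳ-≡ h (r ℕ.* m) p (begin
      h ℕ.* p           ≡⟨ hp≡qm ⟩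
      q ℕ.* m           ≡⟨ cong (ℕ._* m) q≡rp ⟩
      r ℕ.* p ℕ.* m     ≡⟨ ℕ*.xy∙z≈xz∙y r p m ⟩
      r ℕ.* m ℕ.* p     ∎))

  multiples : filter div? (divisors g) ↭ map scale (divisors h)
  multiples = unique∧⊆⊇⇒↭ (Unique.filter⁺ _ (divisors! g)) (Unique.map⁺ scale-injective (divisors! h)) to from
    where
    to : ∀ {i} → i ∈ filter div? (divisors g) → i ∈ map scale (divisors h)
    to {i} i∈ with ∈-filter⁻ div? {xs = divisors g} i∈
    ... | i∈g , divides (suc j) si≡sj*p =
      subst (_∈ map scale (divisors h)) (ℕₚ.suc-injective (trans (suc-scale j) (sym si≡p*sj)))
        (∈-map⁺ scale (∈-divisors⁺ h (*-cancelˡ-∣ p (subst₂ _∣_ si≡p*sj (ℕₚ.*-comm h p) (∈-divisors⁻ g i∈g)))))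
      where si≡p*sj = trans si≡sj*p (ℕₚ.*-comm (suc j) p)
    from : ∀ {i} → i ∈ map scale (divisors h) → i ∈ filter div? (divisors g)
    from i∈ with ∈-map⁻ scale i∈
    ... | j , j∈ , refl = ∈-filter⁺ div?
      (∈-divisors⁺ g (subst₂ _∣_ (sym (suc-scale j)) (ℕₚ.*-comm p h) (*-monoʳ-∣ p (∈-divisors⁻ h j∈))))
      (subst (p ∣_) (sym (suc-scale j)) (m∣m*n (suc j)))

  opposite : ∑ μ⁺ (map scale (divisors h)) ≡ -1ℤ ℤ.* S
  opposite = begin
    ∑ μ⁺ (map scale (divisors h))                                  ≡⟨ ∑-map μ⁺ scale (divisors h) ⟩
    ∑ (μ⁺ ∘ scale) (divisors h)                                    ≡⟨ ∑-cong (divisors h) (λ {i} _ → flip i) ⟩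
    ∑ (λ i → -1ℤ ℤ.* (μ⁺ i ℤ.* 𝟙 (¬? (div? i)))) (divisors h)      ≡⟨ ∑-*ˡ -1ℤ _ (divisors h) ⟩
    -1ℤ ℤ.* ∑ (λ i → μ⁺ i ℤ.* 𝟙 (¬? (div? i))) (divisors h)        ≡⟨ cong (-1ℤ ℤ.*_) (∑-filter (¬? ∘ div?) μ⁺ (divisors h)) ⟨
    -1ℤ ℤ.* S                                                      ∎
    where
    -- If `p` already divides `suc i`, then `p * suc i` contains the square of `p` and contributes
    -- 0, so only the divisors prime to `p` survive.
    flip : ∀ i → μ⁺ (scale i) ≡ -1ℤ ℤ.* (μ⁺ i ℤ.* 𝟙 (¬? (div? i)))
    flip i with div? i
    ... | yes p∣i = trans (p∣m⇒μ[pm]≡0 p-prime (suc i) (suc (scale i)) (suc-scale i) p∣i)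
                          (sym (cong (-1ℤ ℤ.*_) (ℤₚ.*-zeroʳ (μ⁺ i))))
    ... | no p∤i  = trans (p∤m⇒μ[pm]≡-μ[m] p-prime (suc i) (suc (scale i)) (suc-scale i) p∤i)
                          (sym (trans (cong (-1ℤ ℤ.*_) (ℤₚ.*-identityʳ (μ⁺ i))) (ℤₚ.-1*i≡-i (μ⁺ i))))

∑-μ-divisors : (g : ℕ) .{{_ : NonZero g}} → ∑ μ⁺ (divisors g) ≡ 𝟙 (g ℕₚ.≟ 1)
∑-μ-divisors g with g ℕₚ.≟ 1
... | yes refl = refl
... | no g≢1 with ∃-prime-divisor g g≢1
...   | p , p-prime , divides h refl = ∑-μ-divisors-* h p {{ℕₚ.m*n≢0⇒m≢0 h}} p-prime

-- Rotations and powers of lists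


-- Unfolds to the same term as `_^_` on lists of vertex pairs, but for any type of entries, so that
-- it applies to words as well.
power : List A → ℕ → List A
power xs m = concat (replicate m xs)

length-power : (xs : List A) (m : ℕ) → length (power xs m) ≡ m ℕ.* length xs
length-power xs zero    = refl
length-power xs (suc m) = trans (Listₚ.length-++ xs) (cong (length xs ℕ.+_) (length-power xs m))

power-comm : (xs : List A) (m : ℕ) → power xs m ++ xs ≡ xs ++ power xs m
power-comm xs zero    = sym (Listₚ.++-identityʳ xs)
power-comm xs (suc m) = trans (Listₚ.++-assoc xs (power xs m) xs) (cong (xs ++_) (power-comm xs m))

power-[] : (m : ℕ) → power ([] {A = A}) m ≡ []
power-[] zero    = refl
power-[] (suc m) = power-[] m

++-cancel-length : (xs xs′ : List A) {ys ys′ : List A} → length xs ≡ length xs′ →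
  xs ++ ys ≡ xs′ ++ ys′ → xs ≡ xs′ × ys ≡ ys′
++-cancel-length []       []        _  eq = refl , eq
++-cancel-length (x ∷ xs) (y ∷ xs′) el eq with Listₚ.∷-injective eq
... | refl , eq′ with ++-cancel-length xs xs′ (ℕₚ.suc-injective el) eq′
...   | refl , eq″ = refl , eq″

-- From `xs ++ u ≡ u ++ xs` with `u` no longer than `xs`, the list `xs` begins with `u`, and what
-- remains commutes with `u` again; induction on `m`.
commuting⇒power : (u xs : List A) (m : ℕ) → length xs ≡ m ℕ.* length u →
  xs ++ u ≡ u ++ xs → xs ≡ power u m
commuting⇒power u []       zero    el eq = refl
commuting⇒power u xs (suc m) el eq = begin
  xs                                            ≡⟨ Listₚ.take++drop≡id d xs ⟨
  take d xs ++ drop d xs                        ≡⟨ cong (_++ drop d xs) take≡u ⟩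
  u ++ drop d xs                                ≡⟨ cong (u ++_) (commuting⇒power u (drop d xs) m length-drop drop++u≡u++drop) ⟩
  u ++ power u m                                ∎
  where
  open ≡-Reasoning
  d = length u
  length-drop : length (drop d xs) ≡ m ℕ.* d
  length-drop = trans (Listₚ.length-drop d xs) (trans (cong (ℕ._∸ d) el) (ℕₚ.m+n∸m≡n d (m ℕ.* d)))
  split : take d xs ++ (drop d xs ++ u) ≡ u ++ xs
  split = trans (sym (Listₚ.++-assoc (take d xs) (drop d xs) u))
                (trans (cong (_++ u) (Listₚ.take++drop≡id d xs)) eq)
  length-take : length (take d xs) ≡ d
  length-take = trans (Listₚ.length-take d xs)
    (ℕₚ.m≤n⇒m⊓n≡m (subst (d ≤_) (sym el) (ℕₚ.m≤m+n d (m ℕ.* d))))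
  take≡u : take d xs ≡ u
  take≡u = proj₁ (++-cancel-length (take d xs) u length-take split)
  drop++u≡xs : drop d xs ++ u ≡ xs
  drop++u≡xs = proj₂ (++-cancel-length (take d xs) u length-take split)
  drop++u≡u++drop : drop d xs ++ u ≡ u ++ drop d xs
  drop++u≡u++drop = trans drop++u≡xs
    (trans (sym (Listₚ.take++drop≡id d xs)) (cong (_++ drop d xs) take≡u))

rotate : List A → List A
rotate []       = []
rotate (x ∷ xs) = xs ++ [ x ]

rotate^ : ℕ → List A → List A
rotate^ zero    xs = xs
rotate^ (suc d) xs = rotate^ d (rotate xs)

rotate^-+ : (d e : ℕ) (xs : List A) → rotate^ (d ℕ.+ e) xs ≡ rotate^ e (rotate^ d xs)
rotate^-+ zero    e xs = refl
rotate^-+ (suc d) e xs = rotate^-+ d e (rotate xs)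

rotate^-comm : (d e : ℕ) (xs : List A) → rotate^ d (rotate^ e xs) ≡ rotate^ e (rotate^ d xs)
rotate^-comm d e xs = begin
  rotate^ d (rotate^ e xs)  ≡⟨ rotate^-+ e d xs ⟨
  rotate^ (e ℕ.+ d) xs      ≡⟨ cong (λ k → rotate^ k xs) (ℕₚ.+-comm e d) ⟩
  rotate^ (d ℕ.+ e) xs      ≡⟨ rotate^-+ d e xs ⟩
  rotate^ e (rotate^ d xs)  ∎
  where open ≡-Reasoning

rotate^-++ : (xs ys : List A) → rotate^ (length xs) (xs ++ ys) ≡ ys ++ xs
rotate^-++ []       ys = sym (Listₚ.++-identityʳ ys)
rotate^-++ (x ∷ xs) ys = begin
  rotate^ (length xs) ((xs ++ ys) ++ [ x ])  ≡⟨ cong (rotate^ (length xs)) (Listₚ.++-assoc xs ys [ x ]) ⟩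
  rotate^ (length xs) (xs ++ (ys ++ [ x ]))  ≡⟨ rotate^-++ xs (ys ++ [ x ]) ⟩
  (ys ++ [ x ]) ++ xs                        ≡⟨ Listₚ.++-assoc ys [ x ] xs ⟩
  ys ++ x ∷ xs                               ∎
  where open ≡-Reasoning

length-rotate : (xs : List A) → length (rotate xs) ≡ length xs
length-rotate []       = refl
length-rotate (x ∷ xs) = trans (Listₚ.length-++ xs) (ℕₚ.+-comm (length xs) 1)

length-rotate^ : (d : ℕ) (xs : List A) → length (rotate^ d xs) ≡ length xs
length-rotate^ zero    xs = refl
length-rotate^ (suc d) xs = trans (length-rotate^ d (rotate xs)) (length-rotate xs)

rotate^-length : (xs : List A) → rotate^ (length xs) xs ≡ xs
rotate^-length xs = subst (λ ys → rotate^ (length xs) ys ≡ xs) (Listₚ.++-identityʳ xs) (rotate^-++ xs [])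

rotate^-[] : (d : ℕ) → rotate^ d ([] {A = A}) ≡ []
rotate^-[] zero    = refl
rotate^-[] (suc d) = rotate^-[] d

Fixed : ℕ → List A → Set
Fixed d xs = rotate^ d xs ≡ xs

fixed-* : {d : ℕ} {xs : List A} (k : ℕ) → Fixed d xs → Fixed (k ℕ.* d) xs
fixed-* zero f = refl
fixed-* {d = d} {xs} (suc k) f = begin
  rotate^ (d ℕ.+ k ℕ.* d) xs           ≡⟨ rotate^-+ d (k ℕ.* d) xs ⟩
  rotate^ (k ℕ.* d) (rotate^ d xs)     ≡⟨ cong (rotate^ (k ℕ.* d)) f ⟩
  rotate^ (k ℕ.* d) xs                 ≡⟨ fixed-* k f ⟩
  xs                                   ∎
  where open ≡-Reasoning

-- Closure of the periods under subtraction, the step that allows division with remainder in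
-- `leastPeriod`.
fixed-+⁻ : {xs : List A} (d e : ℕ) → Fixed d xs → Fixed (d ℕ.+ e) xs → Fixed e xs
fixed-+⁻ {xs = xs} d e f f′ = trans (cong (rotate^ e) (sym f)) (trans (sym (rotate^-+ d e xs)) f′)

fixed-rotate^ : (d e : ℕ) {xs : List A} → Fixed d xs → Fixed d (rotate^ e xs)
fixed-rotate^ d e {xs} f = trans (rotate^-comm d e xs) (cong (rotate^ e) f)

fixed-power : (xs : List A) (m : ℕ) → Fixed (length xs) (power xs m)
fixed-power xs zero    = rotate^-[] (length xs)
fixed-power xs (suc m) = trans (rotate^-++ xs (power xs m)) (power-comm xs m)

-- Cut off the prefix `u` of length `d`. Rotation by `d` swaps `u` with the rest, so invariance says
-- that the two pieces commute, and `commuting⇒power` applies.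
fixed⇒power : (d m : ℕ) (xs : List A) → length xs ≡ m ℕ.* d → Fixed d xs → ∃[ u ] xs ≡ power u m
fixed⇒power d zero    []  el f = [] , refl
fixed⇒power d (suc m) xs el f = u , commuting⇒power u xs (suc m) el′ comm
  where
  u = take d xs
  length-u : length u ≡ d
  length-u = trans (Listₚ.length-take d xs)
    (ℕₚ.m≤n⇒m⊓n≡m (subst (d ≤_) (sym el) (ℕₚ.m≤m+n d (m ℕ.* d))))
  el′ : length xs ≡ suc m ℕ.* length u
  el′ = trans el (cong (suc m ℕ.*_) (sym length-u))
  xs≡ : u ++ drop d xs ≡ xs
  xs≡ = Listₚ.take++drop≡id d xs
  xs≡′ : drop d xs ++ u ≡ xs
  xs≡′ = begin
    drop d xs ++ u                         ≡⟨ rotate^-++ u (drop d xs) ⟨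
    rotate^ (length u) (u ++ drop d xs)    ≡⟨ cong₂ rotate^ length-u xs≡ ⟩
    rotate^ d xs                           ≡⟨ f ⟩
    xs                                     ∎
    where open ≡-Reasoning
  comm : xs ++ u ≡ u ++ xs
  comm = begin
    xs ++ u               ≡⟨ cong (_++ u) xs≡ ⟨
    (u ++ drop d xs) ++ u ≡⟨ Listₚ.++-assoc u _ u ⟩
    u ++ (drop d xs ++ u) ≡⟨ cong (u ++_) xs≡′ ⟩
    u ++ xs               ∎
    where open ≡-Reasoning

_∼_ : List A → List A → Set
xs ∼ ys = ∃[ d ] rotate^ d xs ≡ ys

∼-sym : {xs ys : List A} → xs ∼ ys → ys ∼ xs
∼-sym {xs = []}     (d , refl) = 0 , rotate^-[] d
∼-sym {xs = x ∷ xs} (d , refl) = d ℕ.* length xs , (begin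
  rotate^ (d ℕ.* length xs) (rotate^ d (x ∷ xs))  ≡⟨ rotate^-+ d _ (x ∷ xs) ⟨
  rotate^ (d ℕ.+ d ℕ.* length xs) (x ∷ xs)        ≡⟨ cong (λ k → rotate^ k (x ∷ xs)) (ℕₚ.*-suc d (length xs)) ⟨
  rotate^ (d ℕ.* suc (length xs)) (x ∷ xs)        ≡⟨ fixed-* d (rotate^-length (x ∷ xs)) ⟩
  x ∷ xs                                          ∎)
  where open ≡-Reasoning

∼-isEquivalence : IsEquivalence (_∼_ {A = A})
∼-isEquivalence = record
  { refl  = 0 , refl
  ; sym   = ∼-sym
  ; trans = λ { {xs} (d , refl) (e , refl) → d ℕ.+ e , rotate^-+ d e xs }
  }

∼-bounded : {xs ys : List A} .{{_ : NonZero (length xs)}} → xs ∼ ys → ∃[ d ] d < length xs × rotate^ d xs ≡ ys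
∼-bounded {xs = xs} {ys} (d , eq) = d % l , m%n<n d l , (begin
  rotate^ (d % l) xs                            ≡⟨ cong (rotate^ (d % l)) (fixed-* (d ℕ./ l) (rotate^-length xs)) ⟨
  rotate^ (d % l) (rotate^ (d ℕ./ l ℕ.* l) xs)    ≡⟨ rotate^-+ (d ℕ./ l ℕ.* l) (d % l) xs ⟨
  rotate^ (d ℕ./ l ℕ.* l ℕ.+ d % l) xs            ≡⟨ cong (λ k → rotate^ k xs) (trans (ℕₚ.+-comm _ (d % l)) (sym (m≡m%n+[m/n]*n d l))) ⟩
  rotate^ d xs                                  ≡⟨ eq ⟩
  ys                                            ∎)
  where
  open ≡-Reasoning
  l = length xs

-- Least periods and exponents of lists

module Exponent (_≟_ : DecidableEquality A) where

  fixed? : (d : ℕ) (xs : List A) → Dec (Fixed d xs)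
  fixed? d xs = Listₚ.≡-dec _≟_ (rotate^ d xs) xs

  _∼?_ : (xs ys : List A) → Dec (xs ∼ ys)
  []         ∼? []       = yes (0 , refl)
  []         ∼? (y ∷ ys) = no λ { (d , eq) → contradiction (trans (sym (rotate^-[] d)) eq) λ () }
  xs@(_ ∷ _) ∼? ys with ℕₚ.anyUpTo? (λ d → Listₚ.≡-dec _≟_ (rotate^ d xs) ys) (length xs)
  ... | yes (d , _ , eq) = yes (d , eq)
  ... | no ¬eq           = no (¬eq ∘ ∼-bounded)

  -- For the empty list the least period is 1 and the exponent is 0, which every m divides.
  record Periodicity (xs : List A) : Set where
    field
      period      : ℕ
      exponent    : ℕ
      period>0    : 0 < period
      fixed       : Fixed period xs
      least       : ∀ {e} → Fixed e xs → period ∣ e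
      length≡     : length xs ≡ exponent ℕ.* period

  private
    LeastPeriod : List A → Set
    LeastPeriod xs = ∃[ d ] 0 < d × Fixed d xs × (∀ {e} → Fixed e xs → d ∣ e)

  -- Descent to a period `d` with no smaller positive one. Such a `d` divides every period `e`,
  -- since a nonzero remainder `e % d` would be a smaller positive period.
  leastPeriod : (xs : List A) (d : ℕ) → 0 < d → Fixed d xs → LeastPeriod xs
  leastPeriod xs = <-rec _ λ d rec 0<d f → search d rec 0<d f
    where
    search : (d : ℕ) → (∀ {e} → e < d → 0 < e → Fixed e xs → LeastPeriod xs) → 0 < d → Fixed d xs → LeastPeriod xs
    search d rec 0<d f with ℕₚ.anyUpTo? (λ e → (0 ℕₚ.<? e) ×-dec fixed? e xs) d
    ... | yes (e , e<d , 0<e , f′) = rec e<d 0<e f′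
    ... | no none = d , 0<d , f , multiple
      where
      instance
        d≢0 : NonZero d
        d≢0 = ℕ.>-nonZero 0<d
      multiple : ∀ {e} → Fixed e xs → d ∣ e
      multiple {e} f′ with e % d in e%d≡
      ... | zero  = divides (e ℕ./ d) (trans (m≡m%n+[m/n]*n e d) (cong (ℕ._+ e ℕ./ d ℕ.* d) e%d≡))
      ... | suc r = contradiction (suc r , subst (_< d) e%d≡ (m%n<n e d) , z<s , fixed-r) none
        where
        fixed-r : Fixed (suc r) xs
        fixed-r = fixed-+⁻ (e ℕ./ d ℕ.* d) (suc r) (fixed-* (e ℕ./ d) f)
          (subst (λ k → Fixed k xs)
            (trans (m≡m%n+[m/n]*n e d) (trans (cong (ℕ._+ e ℕ./ d ℕ.* d) e%d≡) (ℕₚ.+-comm (suc r) _))) f′)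

  periodicity : (xs : List A) → Periodicity xs
  periodicity []         = record
    { period = 1 ; exponent = 0 ; period>0 = z<s ; fixed = refl ; least = λ _ → 1∣ _ ; length≡ = refl }
  periodicity xs@(_ ∷ _) with leastPeriod xs (length xs) z<s (rotate^-length xs)
  ... | d , 0<d , f , least with least (rotate^-length xs)
  ...   | divides g el = record
    { period = d ; exponent = g ; period>0 = 0<d ; fixed = f ; least = least ; length≡ = el }

  exponent : List A → ℕ
  exponent xs = Periodicity.exponent (periodicity xs)

  module _ {xs : List A} where
    open Periodicity (periodicity xs) hiding (exponent)

    -- With `s` the cofactor of `m` in the exponent, `s * period` is a period and equals the length
    -- divided by `m`.
    ∣exponent⇒power : ∀ {m} → m ∣ exponent xs → ∃[ u ] xs ≡ power u m
    ∣exponent⇒power {m} (divides s g≡sm) = fixed⇒power (s ℕ.* period) m xs (begin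
      length xs                  ≡⟨ length≡ ⟩
      exponent xs ℕ.* period     ≡⟨ cong (ℕ._* period) (trans g≡sm (ℕₚ.*-comm s m)) ⟩
      m ℕ.* s ℕ.* period         ≡⟨ ℕₚ.*-assoc m s period ⟩
      m ℕ.* (s ℕ.* period)       ∎) (fixed-* s fixed)
      where open ≡-Reasoning

    -- `length u` is a period of `power u m`, hence `s` times the least one; comparing lengths and
    -- cancelling the period leaves `exponent ≡ s * m`.
    power⇒∣exponent : ∀ {u m} → xs ≡ power u m → m ∣ exponent xs
    power⇒∣exponent {u} {m} refl with least (fixed-power u m)
    ... | divides s |u|≡ = divides s (ℕₚ.*-cancelʳ-≡ (exponent xs) (s ℕ.* m) period {{ℕ.>-nonZero period>0}} (begin
      exponent xs ℕ.* period     ≡⟨ length≡ ⟨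
      length (power u m)         ≡⟨ length-power u m ⟩
      m ℕ.* length u             ≡⟨ cong (m ℕ.*_) |u|≡ ⟩
      m ℕ.* (s ℕ.* period)       ≡⟨ ℕₚ.*-assoc m s period ⟨
      m ℕ.* s ℕ.* period         ≡⟨ cong (ℕ._* period) (ℕₚ.*-comm m s) ⟩
      s ℕ.* m ℕ.* period         ∎))
      where open ≡-Reasoning

    exponent≢0 : .{{_ : NonZero (length xs)}} → NonZero (exponent xs)
    exponent≢0 = ℕₚ.m*n≢0⇒m≢0 (exponent xs) {{subst NonZero length≡ it}}

    primitive⇒length∣ : exponent xs ≡ 1 → ∀ {e} → Fixed e xs → length xs ∣ e
    primitive⇒length∣ g≡1 {e} f =
      subst (_∣ e) (sym (trans length≡ (trans (cong (ℕ._* period) g≡1) (ℕₚ.*-identityˡ period)))) (least f)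

  -- Rotations commute, so periods pass between `xs` and `ys` in both directions and the least
  -- periods divide each other; the lengths agree too.
  exponent-∼ : {xs ys : List A} → xs ∼ ys → exponent ys ≡ exponent xs
  exponent-∼ {xs} {ys} xs∼ys = ℕₚ.*-cancelʳ-≡ (exponent ys) (exponent xs) Pˣ.period {{ℕ.>-nonZero Pˣ.period>0}} (begin
    exponent ys ℕ.* Pˣ.period   ≡⟨ cong (exponent ys ℕ.*_) (∣-antisym (Pˣ.least (transport Pʸ.period (∼-sym xs∼ys) Pʸ.fixed)) (Pʸ.least (transport Pˣ.period xs∼ys Pˣ.fixed))) ⟩
    exponent ys ℕ.* Pʸ.period   ≡⟨ Pʸ.length≡ ⟨
    length ys                   ≡⟨ length-∼ xs∼ys ⟩
    length xs                   ≡⟨ Pˣ.length≡ ⟩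
    exponent xs ℕ.* Pˣ.period   ∎)
    where
    open ≡-Reasoning
    module Pˣ = Periodicity (periodicity xs)
    module Pʸ = Periodicity (periodicity ys)
    transport : ∀ d {us vs} → us ∼ vs → Fixed {A = A} d us → Fixed d vs
    transport d (e , refl) f = fixed-rotate^ d e f
    length-∼ : ∀ {us vs} → us ∼ vs → length {A = A} vs ≡ length us
    length-∼ {us} (e , refl) = length-rotate^ e us

  -- Rotation classes of primitive lists

  module Orbits (l : ℕ) .{{_ : NonZero l}}
    (xss : List (List A)) (xss! : Unique xss)
    (length≡l : ∀ {xs} → xs ∈ xss → length xs ≡ l)
    (exponent≡1 : ∀ {xs} → xs ∈ xss → exponent xs ≡ 1)
    (rotate-closed : ∀ {xs} → xs ∈ xss → rotate xs ∈ xss)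
    where

    module ∼ = IsEquivalence (∼-isEquivalence {A})

    orbitDecSetoid : DecSetoid 0ℓ 0ℓ
    orbitDecSetoid = record
      { isDecEquivalence = record { isEquivalence = ∼-isEquivalence {A} ; _≟_ = _∼?_ } }

    representatives : List (List A)
    representatives = deduplicate _∼?_ xss

    representatives≁ : AllPairs (λ xs ys → ¬ (xs ∼ ys)) representatives
    representatives≁ = deduplicate-! orbitDecSetoid xss

    representative∈ : ∀ {xs} → xs ∈ representatives → xs ∈ xss
    representative∈ = ∈-deduplicate⁻ _∼?_ xss

    representative : ∀ {xs} → xs ∈ xss → Any (xs ∼_) representatives
    representative {xs} xs∈ = Anyₚ.deduplicate⁺ _∼?_ (λ y∼x xs∼x → ∼.trans xs∼x (∼.sym y∼x))
      (Any.map (λ { refl → ∼.refl }) xs∈)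

    -- The position found by `representative` comes from a proof of membership. Pairwise
    -- inequivalence makes it depend on the class alone, hence well defined on orbits.
    index-unique : ∀ {xs : List A} {yss} → AllPairs (λ xs ys → ¬ (xs ∼ ys)) yss →
      (p : Any (xs ∼_) yss) (i : Fin (length yss)) → xs ∼ lookup yss i → Any.index p ≡ i
    index-unique (y≁ ∷ _)   (here xs∼y)  zero    _     = refl
    index-unique (y≁ ∷ _)   (here xs∼y)  (suc i) xs∼y′ =
      contradiction (∼.trans (∼.sym xs∼y) xs∼y′) (All.lookup y≁ (∈-lookup i))
    index-unique (y≁ ∷ _)   (there p)    zero    xs∼y  =
      contradiction (∼.trans (∼.sym xs∼y) (Anyₚ.lookup-index p)) (All.lookup y≁ (∈-lookup (Any.index p)))
    index-unique (_ ∷ yss≁) (there p)    (suc i) xs∼y  = cong suc (index-unique yss≁ p i xs∼y)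

    rotations : List A → List (List A)
    rotations xs = applyUpTo (λ d → rotate^ d xs) l

    rotations! : ∀ {xs} → xs ∈ xss → Unique (rotations xs)
    rotations! {xs} xs∈ = Unique.applyUpTo⁺₁ (λ d → rotate^ d xs) l distinct
      where
      -- Equal rotations by i < j < l would make j - i a period, but l is the least one.
      distinct : ∀ {i j} → i < j → j < l → rotate^ i xs ≢ rotate^ j xs
      distinct {i} {j} i<j j<l eq = ℕₚ.<⇒≱ (ℕₚ.≤-<-trans (ℕₚ.m∸n≤m j i) j<l)
        (∣⇒≤ {{ℕ.>-nonZero (ℕₚ.m<n⇒0<n∸m i<j)}} (subst (_∣ j ∸ i) length-rotated
          (primitive⇒length∣ {rotate^ i xs} (trans (exponent-∼ (i , refl)) (exponent≡1 xs∈)) (begin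
            rotate^ (j ∸ i) (rotate^ i xs)  ≡⟨ rotate^-+ i (j ∸ i) xs ⟨
            rotate^ (i ℕ.+ (j ∸ i)) xs      ≡⟨ cong (λ k → rotate^ k xs) (ℕₚ.m+[n∸m]≡n (ℕₚ.<⇒≤ i<j)) ⟩
            rotate^ j xs                    ≡⟨ eq ⟨
            rotate^ i xs                    ∎))))
        where
        open ≡-Reasoning
        length-rotated : length (rotate^ i xs) ≡ l
        length-rotated = trans (length-rotate^ i xs) (length≡l xs∈)

    rotate^-closed : ∀ d {xs} → xs ∈ xss → rotate^ d xs ∈ xss
    rotate^-closed zero    xs∈ = xs∈
    rotate^-closed (suc d) xs∈ = rotate^-closed d (rotate-closed xs∈)

    -- The partition into classes of size `l`: primitivity separates the rotations of one
    -- representative, inequivalence separates the classes, and rotations by less than `l` reach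
    -- every member.
    rotations↭ : concat (map rotations representatives) ↭ xss
    rotations↭ = unique∧⊆⊇⇒↭
      (Unique.concat⁺ (Allₚ.map⁺ (All.tabulate (rotations! ∘ representative∈)))
                      (AllPairsₚ.map⁺ (AllPairs.map disjoint representatives≁)))
      xss! to from
      where
      disjoint : ∀ {xs ys} → ¬ (xs ∼ ys) → Disjoint (rotations xs) (rotations ys)
      disjoint {xs} {ys} xs≁ys (z∈ , z∈′) =
        let i , _ , z≡  = ∈-applyUpTo⁻ (λ d → rotate^ d xs) z∈
            j , _ , z≡′ = ∈-applyUpTo⁻ (λ d → rotate^ d ys) z∈′
        in xs≁ys (∼.trans (i , sym z≡) (∼.sym (j , sym z≡′)))
      to : ∀ {xs} → xs ∈ concat (map rotations representatives) → xs ∈ xss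
      to xs∈ with ∈-concat⁻′ (map rotations representatives) xs∈
      ... | _ , xs∈′ , ys∈ with ∈-map⁻ rotations ys∈
      ...   | r , r∈ , refl with ∈-applyUpTo⁻ (λ d → rotate^ d r) xs∈′
      ...     | d , _ , refl = rotate^-closed d (representative∈ r∈)
      from : ∀ {xs} → xs ∈ xss → xs ∈ concat (map rotations representatives)
      from {xs} xs∈ with ∈-rep ← ∈-lookup {xs = representatives} (Any.index (representative xs∈))
                    with ∼-bounded {xs = lookup representatives (Any.index (representative xs∈))}
                           {{subst NonZero (sym (length≡l (representative∈ ∈-rep))) it}}
                           (∼.sym (Anyₚ.lookup-index (representative xs∈)))
      ... | d , d<l , eq = ∈-concat⁺′
        (subst (_∈ rotations _) eq (∈-applyUpTo⁺ (λ d → rotate^ d _) (subst (d <_) (length≡l (representative∈ ∈-rep)) d<l)))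
        (∈-map⁺ rotations ∈-rep)

    length-orbits : length xss ≡ length representatives ℕ.* l
    length-orbits = trans (sym (↭-length rotations↭))
      (length-concat-map rotations l (λ xs → Listₚ.length-applyUpTo (λ d → rotate^ d xs) l) representatives)

-- Rational arithmetic

module PR where

-- Checked on unnormalised rationals, where the product of fractions has this numerator and
-- denominator before any reduction.
/-* : ∀ i j d e .{{_ : NonZero d}} .{{_ : NonZero e}} →
  (i / d) ℚ.* (j / e) ≡ ((i ℤ.* j) / (d ℕ.* e)) {{ℕₚ.m*n≢0 d e}}
/-* i j d@(suc d-1) e@(suc e-1) = ℚₚ.toℚᵘ-injective (begin
  toℚᵘ ((i / d) ℚ.* (j / e))            ≈⟨ ℚₚ.toℚᵘ-homo-* (i / d) (j / e) ⟩
  toℚᵘ (i / d) ℚᵘ.* toℚᵘ (j / e)        ≈⟨ ℚᵘₚ.*-cong (ℚₚ.toℚᵘ-fromℚᵘ (mkℚᵘ i d-1)) (ℚₚ.toℚᵘ-fromℚᵘ (mkℚᵘ j e-1)) ⟩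
  mkℚᵘ i d-1 ℚᵘ.* mkℚᵘ j e-1            ≈⟨ ℚₚ.toℚᵘ-fromℚᵘ _ ⟨
  toℚᵘ ((i ℤ.* j) / (d ℕ.* e))          ∎)
  where open import Relation.Binary.Reasoning.Setoid ℚᵘₚ.≃-setoid

/-≡⁺ : ∀ i j d e .{{_ : NonZero d}} .{{_ : NonZero e}} → i ℤ.* + e ≡ j ℤ.* + d → i / d ≡ j / e
/-≡⁺ i j d@(suc d-1) e@(suc e-1) eq = ℚₚ.fromℚᵘ-cong {mkℚᵘ i d-1} {mkℚᵘ j e-1} (*≡* eq)

/-≡⁻ : ∀ i j d e .{{_ : NonZero d}} .{{_ : NonZero e}} → i / d ≡ j / e → i ℤ.* + e ≡ j ℤ.* + d
/-≡⁻ i j d@(suc d-1) e@(suc e-1) eq with ℚₚ.fromℚᵘ-injective {mkℚᵘ i d-1} {mkℚᵘ j e-1} eq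
... | *≡* eq′ = eq′

module _ (i j : ℤ) (d m : ℕ) .{{_ : NonZero d}} .{{_ : NonZero m}} where

  private
    instance
      dm≢0 : NonZero (d ℕ.* m)
      dm≢0 = ℕₚ.m*n≢0 d m

    swap : j ℤ.* + (d ℕ.* m) ≡ + m ℤ.* j ℤ.* + d
    swap = begin
      j ℤ.* + (d ℕ.* m)     ≡⟨ cong (j ℤ.*_) (ℤₚ.pos-* d m) ⟩
      j ℤ.* (+ d ℤ.* + m)   ≡⟨ ℤ*.x∙yz≈zx∙y j (+ d) (+ m) ⟩
      + m ℤ.* j ℤ.* + d     ∎
      where open ≡-Reasoning

  ÷-integral⁺ : i ≡ + m ℤ.* j ℤ.* + d → (i / d) ÷ m ≡ j / 1
  ÷-integral⁺ i≡ = trans (/-* i 1ℤ d m) (/-≡⁺ (i ℤ.* 1ℤ) j (d ℕ.* m) 1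
    (trans (ℤₚ.*-identityʳ (i ℤ.* 1ℤ)) (trans (ℤₚ.*-identityʳ i) (trans i≡ (sym swap)))))

  ÷-integral⁻ : (i / d) ÷ m ≡ j / 1 → i ≡ + m ℤ.* j ℤ.* + d
  ÷-integral⁻ eq = begin
    i                        ≡⟨ trans (ℤₚ.*-identityʳ (i ℤ.* 1ℤ)) (ℤₚ.*-identityʳ i) ⟨
    i ℤ.* 1ℤ ℤ.* + 1         ≡⟨ /-≡⁻ (i ℤ.* 1ℤ) j (d ℕ.* m) 1 (trans (sym (/-* i 1ℤ d m)) eq) ⟩
    j ℤ.* + (d ℕ.* m)        ≡⟨ swap ⟩
    + m ℤ.* j ℤ.* + d        ∎
    where open ≡-Reasoning

-- Replaces the match on lowest terms in `binomial` by equations between rationals, to which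
-- `÷-integral⁺` and `÷-integral⁻` apply.
data BinomialView (p q : ℚ) : ℕ → Set where
  integral : ∀ x y → p ≡ + x / 1 → q ≡ + y / 1 → BinomialView p q (x C y)
  other    : ¬ (∃[ x ] ∃[ y ] p ≡ + x / 1 × q ≡ + y / 1) → BinomialView p q 0

natural : ∀ x → + x / 1 ≡ mkℚ (+ x) 0 (Coprimality.sym (Coprimality.1-coprimeTo x))
natural x = ℚₚ.normalize-coprime (Coprimality.sym (Coprimality.1-coprimeTo x))

↥-natural : ∀ {p} x → p ≡ + x / 1 → ↥ p ≡ + x
↥-natural x eq = cong ↥_ (trans eq (natural x))

↧-natural : ∀ {p} x → p ≡ + x / 1 → ↧ p ≡ 1ℤ
↧-natural x eq = cong ↧_ (trans eq (natural x))

binomialView : ∀ p q → BinomialView p q (binomial p q)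
binomialView (mkℚ (+ x) zero _) (mkℚ (+ y) zero _)       = integral x y (sym (natural x)) (sym (natural y))
binomialView (mkℚ (+ x) zero _) (mkℚ (+ y) (suc d) _)    = other λ (_ , x′ , _ , eq) → contradiction (↧-natural x′ eq) λ ()
binomialView (mkℚ (+ x) zero _) (mkℚ -[1+ y ] d _)       = other λ (_ , x′ , _ , eq) → contradiction (↥-natural x′ eq) λ ()
binomialView (mkℚ (+ x) (suc d) _) q                     = other λ (x′ , _ , eq , _) → contradiction (↧-natural x′ eq) λ ()
binomialView (mkℚ -[1+ x ] d _) q                        = other λ (x′ , _ , eq , _) → contradiction (↥-natural x′ eq) λ ()

-- Floors, ceilings and intervals of integers

ratio : ∀ i d .{{_ : NonZero d}} → ↥ (i / d) ℤ.* + d ≡ i ℤ.* ↧ (i / d)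
ratio i d@(suc d-1) with ℚₚ.toℚᵘ-fromℚᵘ (mkℚᵘ i d-1)
... | *≡* eq = trans (cong (ℤ._* + d) (sym (ℚₚ.↥ᵘ-toℚᵘ (i / d))))
                     (trans eq (cong (i ℤ.*_) (ℚₚ.↧ᵘ-toℚᵘ (i / d))))

module _ (i : ℤ) (d : ℕ) .{{_ : NonZero d}} (k : ℤ) where

  open ℤₚ.≤-Reasoning

  -- `floor` computes on a rational in constructor form, which `i / d` is not. Hence an arbitrary
  -- `p` that cross-multiplies to `i / d`; the ceiling takes `p` to be a negated fraction.
  ≤floor⁻ : ∀ p → ↥ p ℤ.* + d ≡ i ℤ.* ↧ p → k ℤ.≤ floor p → k ℤ.* + d ℤ.≤ i
  ≤floor⁻ (mkℚ u e-1 _) p≡i/d k≤ = ℤₚ.*-cancelʳ-≤-pos (k ℤ.* + d) i (+ suc e-1) (begin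
    k ℤ.* + d ℤ.* + suc e-1           ≡⟨ ℤ*.xy∙z≈xz∙y k (+ d) (+ suc e-1) ⟩
    k ℤ.* + suc e-1 ℤ.* + d           ≤⟨ ℤₚ.*-monoʳ-≤-nonNeg (+ d) (ℤₚ.*-monoʳ-≤-nonNeg (+ suc e-1) k≤) ⟩
    u ℤ./ + suc e-1 ℤ.* + suc e-1 ℤ.* + d   ≤⟨ ℤₚ.*-monoʳ-≤-nonNeg (+ d) (ℤ.[n/d]*d≤n u (+ suc e-1)) ⟩
    u ℤ.* + d                         ≡⟨ p≡i/d ⟩
    i ℤ.* + suc e-1                   ∎)

  -- The floor `q` of `u / e` satisfies `u < (q + 1) * e`, which gives `k < q + 1` after cancelling
  -- both denominators.
  ≤floor⁺ : ∀ p → ↥ p ℤ.* + d ≡ i ℤ.* ↧ p → k ℤ.* + d ℤ.≤ i → k ℤ.≤ floor p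
  ≤floor⁺ (mkℚ u e-1 _) p≡i/d kd≤i = subst (k ℤ.≤_) (sym (ℤ.div-pos-is-/ℕ u (suc e-1)))
    (subst (k ℤ.≤_) (ℤₚ.pred-suc (u ℤ./ℕ suc e-1)) (ℤₚ.i<j⇒i≤pred[j] {k} {ℤ.suc (u ℤ./ℕ suc e-1)} (ℤₚ.*-cancelʳ-<-nonNeg (+ suc e-1) (ℤₚ.*-cancelʳ-<-nonNeg (+ d) (begin-strict
    k ℤ.* + suc e-1 ℤ.* + d           ≡⟨ ℤ*.xy∙z≈xz∙y k (+ suc e-1) (+ d) ⟩
    k ℤ.* + d ℤ.* + suc e-1           ≤⟨ ℤₚ.*-monoʳ-≤-nonNeg (+ suc e-1) kd≤i ⟩
    i ℤ.* + suc e-1                   ≡⟨ p≡i/d ⟨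
    u ℤ.* + d                         <⟨ ℤₚ.*-monoʳ-<-pos (+ d) {{ℤ.positive (ℤ.+<+ (ℕ.>-nonZero⁻¹ d))}} (ℤ.n<s[n/ℕd]*d u (suc e-1)) ⟩
    ℤ.suc (u ℤ./ℕ suc e-1) ℤ.* + suc e-1 ℤ.* + d ∎)))))

module _ (i : ℤ) (d : ℕ) .{{_ : NonZero d}} (k : ℤ) where

  private
    neg-ratio : ↥ (ℚ.- (i / d)) ℤ.* + d ≡ ℤ.- i ℤ.* ↧ (ℚ.- (i / d))
    neg-ratio = begin
      ↥ (ℚ.- (i / d)) ℤ.* + d        ≡⟨ cong (ℤ._* + d) (ℚₚ.↥-neg (i / d)) ⟩
      ℤ.- ↥ (i / d) ℤ.* + d          ≡⟨ ℤₚ.neg-distribˡ-* (↥ (i / d)) (+ d) ⟨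
      ℤ.- (↥ (i / d) ℤ.* + d)        ≡⟨ cong ℤ.-_ (ratio i d) ⟩
      ℤ.- (i ℤ.* ↧ (i / d))          ≡⟨ ℤₚ.neg-distribˡ-* i (↧ (i / d)) ⟩
      ℤ.- i ℤ.* ↧ (i / d)            ≡⟨ cong (ℤ.- i ℤ.*_) (ℚₚ.↧-neg (i / d)) ⟨
      ℤ.- i ℤ.* ↧ (ℚ.- (i / d))      ∎
      where open ≡-Reasoning

    ceiling≡ : ceiling (i / d) ≡ ℤ.- floor (ℚ.- (i / d))
    ceiling≡ with i / d
    ... | mkℚ _ _ _ = refl

  ≤floor : k ℤ.* + d ℤ.≤ i → k ℤ.≤ floor (i / d)
  ≤floor = ≤floor⁺ i d k (i / d) (ratio i d)

  ceiling≤⁺ : i ℤ.≤ k ℤ.* + d → ceiling (i / d) ℤ.≤ k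
  ceiling≤⁺ i≤kd = subst₂ ℤ._≤_ (sym ceiling≡) (ℤₚ.neg-involutive k) (ℤₚ.neg-mono-≤
    (≤floor⁺ (ℤ.- i) d (ℤ.- k) (ℚ.- (i / d)) neg-ratio
      (subst (ℤ._≤ ℤ.- i) (ℤₚ.neg-distribˡ-* k (+ d)) (ℤₚ.neg-mono-≤ i≤kd))))

  ceiling≤⁻ : ceiling (i / d) ℤ.≤ k → i ℤ.≤ k ℤ.* + d
  ceiling≤⁻ c≤k = ℤₚ.neg-cancel-≤ (subst (ℤ._≤ ℤ.- i) (sym (ℤₚ.neg-distribˡ-* k (+ d)))
    (≤floor⁻ (ℤ.- i) d (ℤ.- k) (ℚ.- (i / d)) neg-ratio
      (subst (ℤ.- k ℤ.≤_) (trans (cong ℤ.-_ ceiling≡) (ℤₚ.neg-involutive _)) (ℤₚ.neg-mono-≤ c≤k))))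

interval! : ∀ p q → Unique (interval p q)
interval! p q = Unique.map⁺ (λ {i} {j} eq → ℤₚ.+-injective (ℤ+ᵍ.∙-cancelˡ p (+ i) (+ j) eq)) (Unique.upTo⁺ _)

interval-lower : ∀ p q {k} → k ∈ interval p q → p ℤ.≤ k
interval-lower p q k∈ with ∈-map⁻ (λ i → p ℤ.+ + i) k∈
... | i , _ , refl = ℤₚ.i≤i+j p (+ i)

∈-interval : ∀ p q {k} → p ℤ.≤ k → k ℤ.≤ q → k ∈ interval p q
∈-interval p q {k} p≤k k≤q
  -- The length of `interval` is a case distinction on `suc q - p`. Abstracting that integer along
  -- with the bound on `k - p` lets it compute, and `∣ k - p ∣` is the position of `k`.
  with ℤ.suc q ℤ.- p | ℤₚ.+-monoˡ-< (ℤ.- p) (ℤₚ.suc[i]≤j⇒i<j {k} (ℤₚ.suc-mono k≤q)) | ℤ.∣ k ℤ.- p ∣ | ℤₚ.0≤i⇒+∣i∣≡i (ℤₚ.i≤j⇒0≤j-i p≤k)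
... | + s      | k-p<s | i | i≡ = subst (_∈ map (λ i → p ℤ.+ + i) (upTo s)) p+i≡k
  (∈-map⁺ (λ i → p ℤ.+ + i) (∈-upTo⁺ (ℤₚ.drop‿+<+ (subst (ℤ._< + s) (sym i≡) k-p<s))))
  where
  p+i≡k : p ℤ.+ + i ≡ k
  p+i≡k = begin
    p ℤ.+ + i           ≡⟨ cong (ℤ._+_ p) i≡ ⟩
    p ℤ.+ (k ℤ.- p)     ≡⟨ ℤ+.x∙yz≈y∙xz p k (ℤ.- p) ⟩
    k ℤ.+ (p ℤ.- p)     ≡⟨ cong (ℤ._+_ k) (ℤₚ.+-inverseʳ p) ⟩
    k ℤ.+ 0ℤ            ≡⟨ ℤₚ.+-identityʳ k ⟩
    k                   ∎
    where open ≡-Reasoning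
... | -[1+ s ] | k-p<s | i | i≡ = contradiction (subst (ℤ._< -[1+ s ]) (sym i≡) k-p<s) λ ()

+-minus⁺ : ∀ i j k → i ≡ j ℕ.+ k → + i ℤ.- + j ≡ + k
+-minus⁺ i j k refl = trans (cong (ℤ._- + j) (ℤₚ.pos-+ j k)) (ℤ+ᵍ.xyx⁻¹≈y (+ j) (+ k))

+-minus⁻ : ∀ i j k → + i ℤ.- + j ≡ + k → i ≡ j ℕ.+ k
+-minus⁻ i j k eq = ℤₚ.+-injective (begin
  + i                       ≡⟨ ℤₚ.+-identityʳ (+ i) ⟨
  + i ℤ.+ 0ℤ                ≡⟨ cong (ℤ._+_ (+ i)) (ℤₚ.+-inverseˡ (+ j)) ⟨
  + i ℤ.+ (ℤ.- + j ℤ.+ + j) ≡⟨ ℤₚ.+-assoc (+ i) (ℤ.- + j) (+ j) ⟨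
  + i ℤ.- + j ℤ.+ + j       ≡⟨ cong (ℤ._+ + j) eq ⟩
  + k ℤ.+ + j               ≡⟨ ℤₚ.+-comm (+ k) (+ j) ⟩
  + j ℤ.+ + k               ≡⟨ ℤₚ.pos-+ j k ⟨
  + (j ℕ.+ k)               ∎)
  where open ≡-Reasoning

-- Circuits and their windings

module Winding (n a b : ℕ) .{{_ : NonZero n}} (a<b : a < b) (b<n : b < n) where

  open Circulant n a b hiding (Connected; PrimitiveOrbits)

  toℕ-⊕ : ∀ v s → toℕ (v ⊕ s) ≡ (toℕ v ℕ.+ s) % n
  toℕ-⊕ v s = Finₚ.toℕ-fromℕ< (m%n<n (toℕ v ℕ.+ s) n)

  ⊕-+ : ∀ v s t → (v ⊕ s) ⊕ t ≡ v ⊕ (s ℕ.+ t)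
  ⊕-+ v s t = Finₚ.toℕ-injective (begin
    toℕ ((v ⊕ s) ⊕ t)                         ≡⟨ toℕ-⊕ (v ⊕ s) t ⟩
    (toℕ (v ⊕ s) ℕ.+ t) % n                   ≡⟨ cong (λ k → (k ℕ.+ t) % n) (toℕ-⊕ v s) ⟩
    ((toℕ v ℕ.+ s) % n ℕ.+ t) % n             ≡⟨ %-distribˡ-+ ((toℕ v ℕ.+ s) % n) t n ⟩
    ((toℕ v ℕ.+ s) % n % n ℕ.+ t % n) % n     ≡⟨ cong (λ k → (k ℕ.+ t % n) % n) (m%n%n≡m%n (toℕ v ℕ.+ s) n) ⟩
    ((toℕ v ℕ.+ s) % n ℕ.+ t % n) % n         ≡⟨ %-distribˡ-+ (toℕ v ℕ.+ s) t n ⟨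
    (toℕ v ℕ.+ s ℕ.+ t) % n                   ≡⟨ cong (_% n) (ℕₚ.+-assoc (toℕ v) s t) ⟩
    (toℕ v ℕ.+ (s ℕ.+ t)) % n                 ≡⟨ toℕ-⊕ v (s ℕ.+ t) ⟨
    toℕ (v ⊕ (s ℕ.+ t))                       ∎)
    where open ≡-Reasoning

  ∣⇒⊕-fixed : ∀ v {t} → n ∣ t → v ⊕ t ≡ v
  ∣⇒⊕-fixed v {t} n∣t = Finₚ.toℕ-injective
    (trans (toℕ-⊕ v t) (trans (%-remove-+ʳ (toℕ v) n∣t) (m<n⇒m%n≡m (Finₚ.toℕ<n v))))

  ⊕-fixed⇒∣ : ∀ v {t} → v ⊕ t ≡ v → n ∣ t
  ⊕-fixed⇒∣ v {t} eq = divides q (ℕₚ.+-cancelˡ-≡ (toℕ v) t (q ℕ.* n) (begin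
    toℕ v ℕ.+ t                                     ≡⟨ m≡m%n+[m/n]*n (toℕ v ℕ.+ t) n ⟩
    (toℕ v ℕ.+ t) % n ℕ.+ q ℕ.* n                   ≡⟨ cong (ℕ._+ q ℕ.* n) (trans (sym (toℕ-⊕ v t)) (cong toℕ eq)) ⟩
    toℕ v ℕ.+ q ℕ.* n                               ∎))
    where
    open ≡-Reasoning
    q = (toℕ v ℕ.+ t) ℕ./ n

  step : Bool → ℕ
  step false = a
  step true  = b

  -- Equal endpoints would make `n` divide `b ∸ a`, which is positive and less than `n`.
  ⊕-step-injective : ∀ v {s s′} → v ⊕ step s ≡ v ⊕ step s′ → s ≡ s′
  ⊕-step-injective v {false} {false} eq = refl
  ⊕-step-injective v {true}  {true}  eq = refl
  ⊕-step-injective v {true}  {false} eq = sym (⊕-step-injective v {false} {true} (sym eq))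
  ⊕-step-injective v {false} {true}  eq = contradiction (∣⇒≤ {{ℕ.>-nonZero (ℕₚ.m<n⇒0<n∸m a<b)}} n∣b∸a)
    (ℕₚ.<⇒≱ (ℕₚ.≤-<-trans (ℕₚ.m∸n≤m b a) b<n))
    where
    n∣b∸a : n ∣ b ∸ a
    n∣b∸a = ⊕-fixed⇒∣ (v ⊕ a) (trans (⊕-+ v a (b ∸ a))
      (trans (cong (v ⊕_) (ℕₚ.m+[n∸m]≡n (ℕₚ.<⇒≤ a<b))) (sym eq)))

  path : Vertex → List Bool → List VertexPair
  path v []      = []
  path v (s ∷ w) = (v , v ⊕ step s) ∷ path (v ⊕ step s) w

  -- The displacement in ℕ before reduction mod `n`: a path is closed when `n` divides it, and the
  -- quotient is the winding.
  total : List Bool → ℕ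
  total []      = 0
  total (s ∷ w) = step s ℕ.+ total w

  count : List Bool → ℕ
  count []          = 0
  count (false ∷ w) = count w
  count (true ∷ w)  = suc (count w)

  total-++ : ∀ w w′ → total (w ++ w′) ≡ total w ℕ.+ total w′
  total-++ []      w′ = refl
  total-++ (s ∷ w) w′ = trans (cong (step s ℕ.+_) (total-++ w w′)) (sym (ℕₚ.+-assoc (step s) (total w) (total w′)))

  total-power : ∀ w m → total (power w m) ≡ m ℕ.* total w
  total-power w zero    = refl
  total-power w (suc m) = trans (total-++ w (power w m)) (cong (total w ℕ.+_) (total-power w m))

  -- The source of `kω`: for length `l` and total `ω * n`, solving for `count w` gives
  -- `(ω n - l a) / (b - a)`.
  total-count : ∀ w → total w ≡ length w ℕ.* a ℕ.+ count w ℕ.* (b ∸ a)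
  total-count []          = refl
  total-count (false ∷ w) = trans (cong (a ℕ.+_) (total-count w)) (sym (ℕₚ.+-assoc a (length w ℕ.* a) _))
  total-count (true ∷ w)  = begin
    b ℕ.+ total w                                          ≡⟨ cong₂ ℕ._+_ (sym (ℕₚ.m+[n∸m]≡n (ℕₚ.<⇒≤ a<b))) (total-count w) ⟩
    (a ℕ.+ (b ∸ a)) ℕ.+ (length w ℕ.* a ℕ.+ count w ℕ.* (b ∸ a))
      ≡⟨ ℕ+.interchange a (b ∸ a) _ _ ⟩
    (a ℕ.+ length w ℕ.* a) ℕ.+ ((b ∸ a) ℕ.+ count w ℕ.* (b ∸ a)) ∎
    where open ≡-Reasoning

  -- Together with `total≤`, the origin of the bounds of summation for `ω`.
  total≥ : ∀ w → length w ℕ.* a ≤ total w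
  total≥ []          = ℕₚ.≤-refl
  total≥ (false ∷ w) = ℕₚ.+-monoʳ-≤ a (total≥ w)
  total≥ (true ∷ w)  = ℕₚ.+-mono-≤ (ℕₚ.<⇒≤ a<b) (total≥ w)

  total≤ : ∀ w → total w ≤ length w ℕ.* b
  total≤ []          = ℕₚ.≤-refl
  total≤ (false ∷ w) = ℕₚ.+-mono-≤ (ℕₚ.<⇒≤ a<b) (total≤ w)
  total≤ (true ∷ w)  = ℕₚ.+-monoʳ-≤ b (total≤ w)

  length-path : ∀ v w → length (path v w) ≡ length w
  length-path v []      = refl
  length-path v (s ∷ w) = cong suc (length-path (v ⊕ step s) w)

  path-injective : ∀ {v v′ w w′} → path v w ≡ path v′ w′ → w ≡ w′
  path-injective {w = []}    {[]}      eq = refl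
  path-injective {v} {v′} {s ∷ w} {s′ ∷ w′} eq
    with refl ← ,-injectiveˡ (Listₚ.∷-injectiveˡ eq)
    with refl ← ⊕-step-injective v {s} {s′} (,-injectiveʳ (Listₚ.∷-injectiveˡ eq))
    = cong (s ∷_) (path-injective (Listₚ.∷-injectiveʳ eq))

  path-injective-start : ∀ {v v′ w w′} .{{_ : NonZero (length w)}} → path v w ≡ path v′ w′ → v ≡ v′
  path-injective-start {w = _ ∷ _} {_ ∷ _} eq = ,-injectiveˡ (Listₚ.∷-injectiveˡ eq)

  path-++ : ∀ v w w′ → path v (w ++ w′) ≡ path v w ++ path (v ⊕ total w) w′
  path-++ v [] w′      = cong (λ u → path u w′) (sym (∣⇒⊕-fixed v (n ∣0)))
  path-++ v (s ∷ w) w′ = cong (_ ∷_) (trans (path-++ (v ⊕ step s) w w′)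
    (cong (λ u → path (v ⊕ step s) w ++ path u w′) (⊕-+ v (step s) (total w))))

  path-split : ∀ {v} w xs {ys} → path v w ≡ xs ++ ys →
    ∃[ w₁ ] ∃[ w₂ ] w ≡ w₁ ++ w₂ × xs ≡ path v w₁ × ys ≡ path (v ⊕ total w₁) w₂
  path-split {v} w       []       eq = [] , w , refl , refl , trans (sym eq) (path-++ v [] w)
  path-split {v} (s ∷ w) (x ∷ xs) eq with path-split w xs (Listₚ.∷-injectiveʳ eq)
  ... | w₁ , w₂ , w≡ , xs≡ , ys≡ = s ∷ w₁ , w₂ , cong (s ∷_) w≡ , cong₂ _∷_ (sym (Listₚ.∷-injectiveˡ eq)) xs≡ ,
    trans ys≡ (cong (λ u → path u w₂) (⊕-+ v (step s) (total w₁)))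

  path-power : ∀ v {w} m → n ∣ total w → path v (power w m) ≡ power (path v w) m
  path-power v {w} zero    n∣ = refl
  path-power v {w} (suc m) n∣ = begin
    path v (w ++ power w m)                       ≡⟨ path-++ v w (power w m) ⟩
    path v w ++ path (v ⊕ total w) (power w m)    ≡⟨ cong (λ u → path v w ++ path u (power w m)) (∣⇒⊕-fixed v n∣) ⟩
    path v w ++ path v (power w m)                ≡⟨ cong (path v w ++_) (path-power v m n∣) ⟩
    path v w ++ power (path v w) m                ∎
    where open ≡-Reasoning

  bond-step : ∀ {v v′} → IsBond (v , v′) → ∃[ s ] v′ ≡ v ⊕ step s
  bond-step (inj₁ eq) = false , eq
  bond-step (inj₂ eq) = true , eq

  isPath⇒path : ∀ {e es} → IsPath (e ∷ es) → ∃[ w ] e ∷ es ≡ path (origin e) w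
  isPath⇒path {es = []}     (bond ∷ _ , _) with bond-step bond
  ... | s , refl = [ s ] , refl
  isPath⇒path {es = f ∷ fs} (bond ∷ bonds , refl ∷ linked) with bond-step bond | isPath⇒path (bonds , linked)
  ... | s , refl | w , eq = s ∷ w , cong (_ ∷_) eq

  path-isPath : ∀ v w → IsPath (path v w)
  path-isPath v w = bonds v w , linked v w
    where
    bonds : ∀ v w → All IsBond (path v w)
    bonds v []          = []
    bonds v (false ∷ w) = inj₁ refl ∷ bonds (v ⊕ a) w
    bonds v (true ∷ w)  = inj₂ refl ∷ bonds (v ⊕ b) w
    linked : ∀ v w → Linked (λ e f → terminus e ≡ origin f) (path v w)
    linked v []           = []
    linked v (s ∷ [])     = [-]
    linked v (s ∷ s′ ∷ w) = refl ∷ linked (v ⊕ step s) (s′ ∷ w)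

  path-terminus : ∀ v s w → Maybe.map terminus (last (path v (s ∷ w))) ≡ just (v ⊕ total (s ∷ w))
  path-terminus v s []       = cong (λ t → just (v ⊕ t)) (sym (ℕₚ.+-identityʳ (step s)))
  path-terminus v s (s′ ∷ w) = trans (path-terminus (v ⊕ step s) s′ w) (cong just (⊕-+ v (step s) (total (s′ ∷ w))))

  path-circuit : ∀ v w → n ∣ total w → IsCircuit (path v w)
  path-circuit v []      n∣ = path-isPath v [] , refl
  path-circuit v (s ∷ w) n∣ = path-isPath v (s ∷ w) , trans (path-terminus v s w) (cong just (∣⇒⊕-fixed v n∣))

  circuit⇒path : ∀ {c} → IsCircuit c → c ≢ [] → ∃[ v ] ∃[ w ] c ≡ path v w × n ∣ total w
  circuit⇒path {[]}    _ c≢[] = contradiction refl c≢[]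
  circuit⇒path {_ ∷ _} (p , closed) _ with isPath⇒path p
  ... | s ∷ w , refl = _ , s ∷ w , refl , ⊕-fixed⇒∣ _ (just-injective (trans (sym (path-terminus _ s w)) closed))

  -- The second copy of u starts where the first one ends, so u is closed.
  path-root : ∀ {v w u m} → path v w ≡ power u (suc m) → length u ≢ 0 → n ∣ total w →
    ∃[ w₁ ] u ≡ path v w₁ × n ∣ total w₁
  -- With one copy only, `u` is the whole circuit and closed by hypothesis.
  path-root {w = w} {u} {zero} eq u≢[] n∣ =
    w , sym (trans eq (Listₚ.++-identityʳ u)) , n∣
  path-root {v} {w} {u} {suc m} eq u≢[] n∣ with path-split w u eq
  ... | w₁ , w₂ , _ , u≡ , rest≡ with path-split w₂ u (sym rest≡)
  ...   | w₁′ , _ , _ , u≡′ , _ = w₁ , u≡ , ⊕-fixed⇒∣ v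
    (sym (path-injective-start {{ℕ.≢-nonZero (u≢[] ∘ trans (trans (cong length u≡) (length-path v w₁)))}} (trans (sym u≡) u≡′)))

  -- Closedness puts the moved bond at the right place: the walk along `w` from `v ⊕ step s` ends at
  -- `v`, where that bond starts.
  rotate-path : ∀ v s w → n ∣ total (s ∷ w) → rotate (path v (s ∷ w)) ≡ path (v ⊕ step s) (w ++ [ s ])
  rotate-path v s w n∣ = sym (begin
    path v′ (w ++ [ s ])                    ≡⟨ path-++ v′ w [ s ] ⟩
    path v′ w ++ path (v′ ⊕ total w) [ s ]  ≡⟨ cong (λ u → path v′ w ++ path u [ s ]) (trans (⊕-+ v (step s) (total w)) (∣⇒⊕-fixed v n∣)) ⟩
    path v′ w ++ path v [ s ]               ∎)
    where
    open ≡-Reasoning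
    v′ = v ⊕ step s

  total-rotate : ∀ w → total (rotate w) ≡ total w
  total-rotate []      = refl
  total-rotate (s ∷ w) = trans (total-++ w [ s ])
    (trans (cong (total w ℕ.+_) (ℕₚ.+-identityʳ (step s))) (ℕₚ.+-comm (total w) (step s)))

  -- Words counted by their letters

  words : ℕ → List (List Bool)
  words zero    = [ [] ]
  words (suc x) = map (false ∷_) (words x) ++ map (true ∷_) (words x)

  ∈-words⁺ : ∀ w → w ∈ words (length w)
  ∈-words⁺ []          = here refl
  ∈-words⁺ (false ∷ w) = ∈-++⁺ˡ (∈-map⁺ (false ∷_) (∈-words⁺ w))
  ∈-words⁺ (true ∷ w)  = ∈-++⁺ʳ _ (∈-map⁺ (true ∷_) (∈-words⁺ w))

  ∈-words⁻ : ∀ x {w} → w ∈ words x → length w ≡ x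
  ∈-words⁻ zero    (here refl) = refl
  ∈-words⁻ (suc x) w∈ with ∈-++⁻ (map (false ∷_) (words x)) w∈
  ... | inj₁ w∈′ with w , w∈″ , refl ← ∈-map⁻ (false ∷_) w∈′ = cong suc (∈-words⁻ x w∈″)
  ... | inj₂ w∈′ with w , w∈″ , refl ← ∈-map⁻ (true ∷_) w∈′ = cong suc (∈-words⁻ x w∈″)

  words! : ∀ x → Unique (words x)
  words! zero    = [] ∷ []
  words! (suc x) = Unique.++⁺ (Unique.map⁺ Listₚ.∷-injectiveʳ (words! x)) (Unique.map⁺ Listₚ.∷-injectiveʳ (words! x))
    λ (w∈ , w∈′) → disjoint (∈-map⁻ (false ∷_) w∈) (∈-map⁻ (true ∷_) w∈′)
    where
    disjoint : ∀ {w} → ∃[ u ] u ∈ words x × w ≡ false ∷ u → ¬ (∃[ u ] u ∈ words x × w ≡ true ∷ u)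
    disjoint (_ , _ , refl) (_ , _ , ())

  -- Pascal's rule, by splitting the words according to their first letter.
  ∑-count≡ : ∀ x k → ∑ (λ w → 𝟙 (count w ℕₚ.≟ k)) (words x) ≡ + (x C k)
  ∑-count≡ zero    zero    = refl
  ∑-count≡ zero    (suc k) = refl
  ∑-count≡ (suc x) k = begin
    ∑ f (map (false ∷_) (words x) ++ map (true ∷_) (words x))  ≡⟨ ∑-++ f (map (false ∷_) (words x)) _ ⟩
    ∑ f (map (false ∷_) (words x)) ℤ.+ ∑ f (map (true ∷_) (words x))
      ≡⟨ cong₂ ℤ._+_ (∑-map f (false ∷_) (words x)) (∑-map f (true ∷_) (words x)) ⟩
    ∑ (λ w → 𝟙 (count w ℕₚ.≟ k)) (words x) ℤ.+ ∑ (λ w → 𝟙 (suc (count w) ℕₚ.≟ k)) (words x)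
      ≡⟨ pascal k ⟩
    + (suc x C k)                                              ∎
    where
    open ≡-Reasoning
    f : List Bool → ℤ
    f w = 𝟙 (count w ℕₚ.≟ k)
    pascal : ∀ k → ∑ (λ w → 𝟙 (count w ℕₚ.≟ k)) (words x) ℤ.+ ∑ (λ w → 𝟙 (suc (count w) ℕₚ.≟ k)) (words x) ≡ + (suc x C k)
    pascal zero    = cong₂ ℤ._+_ (∑-count≡ x 0)
      (trans (∑-cong (words x) λ {w} _ → 𝟙-no (suc (count w) ℕₚ.≟ 0) λ ()) (∑-zero (words x)))
    pascal (suc k) = begin
      ∑ (λ w → 𝟙 (count w ℕₚ.≟ suc k)) (words x) ℤ.+ ∑ (λ w → 𝟙 (suc (count w) ℕₚ.≟ suc k)) (words x)
        ≡⟨ cong₂ ℤ._+_ (∑-count≡ x (suc k)) (trans (∑-cong (words x) λ {w} _ → 𝟙-cong (suc (count w) ℕₚ.≟ suc k) (count w ℕₚ.≟ k) ℕₚ.suc-injective (cong suc)) (∑-count≡ x k)) ⟩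
      + (x C suc k ℕ.+ x C k)   ≡⟨ cong +_ (trans (ℕₚ.+-comm (x C suc k) (x C k)) (nCk+nC[k+1]≡[n+1]C[k+1] x k)) ⟩
      + (suc x C suc k)         ∎

  -- Circuits of given length and winding, and their powers

  open Exponent (≡-dec (Finₚ._≟_ {n}) (Finₚ._≟_ {n})) public

  circuitWords : ℕ → ℕ → List (List Bool)
  circuitWords x t = filter (λ w → total w ℕₚ.≟ t ℕ.* n) (words x)

  -- The circuits of length x winding t times around ℤₙ.
  circuits : ℕ → ℕ → List (List VertexPair)
  circuits x t = cartesianProductWith path (allFin n) (circuitWords x t)

  module _ (x t : ℕ) where

    ∈-circuitWords⁻ : ∀ {w} → w ∈ circuitWords x t → length w ≡ x × total w ≡ t ℕ.* n
    ∈-circuitWords⁻ w∈ = let w∈′ , total≡ = ∈-filter⁻ (λ w → total w ℕₚ.≟ t ℕ.* n) {xs = words x} w∈ in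
      ∈-words⁻ x w∈′ , total≡

    ∈-circuits⁺ : ∀ {w} v → length w ≡ x → total w ≡ t ℕ.* n → path v w ∈ circuits x t
    ∈-circuits⁺ {w} v refl total≡ = ∈-cartesianProductWith⁺ path (∈-allFin v)
      (∈-filter⁺ (λ w → total w ℕₚ.≟ t ℕ.* n) (∈-words⁺ w) total≡)

    ∈-circuits⁻ : ∀ {c} → c ∈ circuits x t → ∃[ v ] ∃[ w ] c ≡ path v w × length w ≡ x × total w ≡ t ℕ.* n
    ∈-circuits⁻ c∈ = let v , w , _ , w∈ , c≡ = ∈-cartesianProductWith⁻ path (allFin n) (circuitWords x t) c∈ in
      v , w , c≡ , ∈-circuitWords⁻ w∈

    circuits! : .{{_ : NonZero x}} → Unique (circuits x t)
    circuits! = unique-cartesianProductWith path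
      (λ y∈ _ eq → path-injective-start {{subst NonZero (sym (proj₁ (∈-circuitWords⁻ y∈))) it}} eq , path-injective eq)
      (Unique.allFin⁺ n) (Unique.filter⁺ _ (words! x))

    length-circuits : length (circuits x t) ≡ n ℕ.* length (circuitWords x t)
    length-circuits = trans (length-cartesianProductWith path (allFin n) (circuitWords x t))
      (cong (ℕ._* length (circuitWords x t)) (Listₚ.length-tabulate {n = n} _))

    circuits-length : ∀ {c} → c ∈ circuits x t → length c ≡ x
    circuits-length c∈ with ∈-circuits⁻ c∈
    ... | v , w , refl , length≡ , _ = trans (length-path v w) length≡

    circuits-isCircuit : ∀ {c} → c ∈ circuits x t → IsCircuit c
    circuits-isCircuit c∈ with ∈-circuits⁻ c∈
    ... | v , w , refl , _ , total≡ = path-circuit v w (divides t total≡)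

    circuits-rotate : ∀ {c} → c ∈ circuits x t → rotate c ∈ circuits x t
    circuits-rotate c∈ with ∈-circuits⁻ c∈
    ... | v , []    , refl , length≡ , total≡ = ∈-circuits⁺ v length≡ total≡
    ... | v , s ∷ w , refl , length≡ , total≡ =
      subst (_∈ circuits x t) (sym (rotate-path v s w (divides t total≡)))
        (∈-circuits⁺ (v ⊕ step s) (trans (length-rotate (s ∷ w)) length≡) (trans (total-rotate (s ∷ w)) total≡))

  -- Once `path-root` shows that `u` is closed, both sides are paths from `v`, so `w` is a power of
  -- the word of `u`, and comparing totals divides the winding by `m`. A zero `m` or an empty `u`
  -- would make `c` empty, against `x ≢ 0`.
  circuits-root : ∀ x t {c} u m .{{_ : NonZero x}} → c ∈ circuits x t → c ≡ power u m →
    ∃[ t′ ] t ≡ m ℕ.* t′ × u ∈ circuits (length u) t′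
  circuits-root x t u zero c∈ refl = contradiction (circuits-length x t c∈) (ℕ.≢-nonZero⁻¹ x ∘ sym)
  circuits-root x t [] (suc m) c∈ refl =
    contradiction (trans (cong length (sym (power-[] (suc m)))) (circuits-length x t c∈)) (ℕ.≢-nonZero⁻¹ x ∘ sym)
  circuits-root x t u@(_ ∷ _) (suc m) c∈ eq with ∈-circuits⁻ x t c∈
  ... | v , w , refl , length≡ , total≡ with path-root {w = w} {u} {m} eq (λ ()) (divides t total≡)
  ...   | w₁ , u≡ , divides t′ total₁≡ = t′ , ℕₚ.*-cancelʳ-≡ t (suc m ℕ.* t′) n (begin
    t ℕ.* n                    ≡⟨ total≡ ⟨
    total w                    ≡⟨ cong total w≡ ⟩
    total (power w₁ (suc m))   ≡⟨ total-power w₁ (suc m) ⟩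
    suc m ℕ.* total w₁         ≡⟨ cong (suc m ℕ.*_) total₁≡ ⟩
    suc m ℕ.* (t′ ℕ.* n)       ≡⟨ ℕₚ.*-assoc (suc m) t′ n ⟨
    suc m ℕ.* t′ ℕ.* n         ∎) ,
    subst (λ c → c ∈ circuits (length u) t′) (sym u≡)
      (∈-circuits⁺ (length u) t′ v (trans (sym (length-path v w₁)) (cong length (sym u≡))) total₁≡)
    where
    open ≡-Reasoning
    w≡ : w ≡ power w₁ (suc m)
    w≡ = path-injective (trans eq (trans (cong (λ c → power c (suc m)) u≡)
           (sym (path-power v (suc m) (divides t′ total₁≡)))))

  circuits-power : ∀ x t {c} m → c ∈ circuits x t → power c m ∈ circuits (m ℕ.* x) (m ℕ.* t)
  circuits-power x t m c∈ with ∈-circuits⁻ x t c∈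
  ... | v , w , refl , length≡ , total≡ = subst (_∈ circuits (m ℕ.* x) (m ℕ.* t)) (path-power v m (divides t total≡))
    (∈-circuits⁺ (m ℕ.* x) (m ℕ.* t) v (trans (length-power w m) (cong (m ℕ.*_) length≡))
      (trans (total-power w m) (trans (cong (m ℕ.*_) total≡) (sym (ℕₚ.*-assoc m t n)))))

  exponent∣winding : ∀ x t {c} .{{_ : NonZero x}} → c ∈ circuits x t → exponent c ∣ t
  exponent∣winding x t {c} c∈ =
    let u , c≡         = ∣exponent⇒power {c} ∣-refl
        t′ , t≡ , _ = circuits-root x t u (exponent c) c∈ c≡
    in divides t′ (trans t≡ (ℕₚ.*-comm (exponent c) t′))

  -- The bijection `u ↦ u^m`: injective because `u` is the prefix of length `x`, onto by
  -- `circuits-root`.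
  circuits-powers : ∀ x t m .{{_ : NonZero x}} .{{_ : NonZero m}} →
    filter (λ c → m ∣? exponent c) (circuits (m ℕ.* x) (m ℕ.* t)) ↭ map (λ u → power u m) (circuits x t)
  circuits-powers x t m@(suc m-1) = unique∧⊆⊇⇒↭
    (Unique.filter⁺ _ (circuits! (m ℕ.* x) (m ℕ.* t) {{ℕₚ.m*n≢0 m x}})) (unique-map injective (circuits! x t)) to from
    where
    injective : ∀ {u u′} → u ∈ circuits x t → u′ ∈ circuits x t → power u m ≡ power u′ m → u ≡ u′
    injective {u} {u′} u∈ u′∈ eq = proj₁ (++-cancel-length u u′ (trans (circuits-length x t u∈) (sym (circuits-length x t u′∈))) eq)
    to : ∀ {c} → c ∈ filter (λ c → m ∣? exponent c) (circuits (m ℕ.* x) (m ℕ.* t)) → c ∈ map (λ u → power u m) (circuits x t)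
    to {c} c∈ with ∈-filter⁻ (λ c → m ∣? exponent c) {xs = circuits (m ℕ.* x) (m ℕ.* t)} c∈
    ... | c∈′ , m∣ with ∣exponent⇒power {c} m∣
    ...   | u , refl with circuits-root (m ℕ.* x) (m ℕ.* t) u m {{ℕₚ.m*n≢0 m x}} c∈′ refl
    ...     | t′ , mt≡ , u∈ = ∈-map⁺ (λ u → power u m) (subst₂ (λ x t → u ∈ circuits x t)
      (ℕₚ.*-cancelˡ-≡ (length u) x m (trans (sym (length-power u m)) (circuits-length (m ℕ.* x) (m ℕ.* t) c∈′)))
      (ℕₚ.*-cancelˡ-≡ t′ t m (sym mt≡)) u∈)
    from : ∀ {c} → c ∈ map (λ u → power u m) (circuits x t) → c ∈ filter (λ c → m ∣? exponent c) (circuits (m ℕ.* x) (m ℕ.* t))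
    from c∈ with ∈-map⁻ (λ u → power u m) c∈
    ... | u , u∈ , refl = ∈-filter⁺ (λ c → m ∣? exponent c) (circuits-power x t m u∈) (power⇒∣exponent {u = u} {m} refl)

  private instance
    b∸a≢0 : NonZero (b ∸ a)
    b∸a≢0 = ℕ.>-nonZero (ℕₚ.m<n⇒0<n∸m a<b)

  -- For words of fixed length, prescribing the total is prescribing the number of letters `b`, by
  -- `total-count`.
  length-circuitWords : ∀ x t y → t ℕ.* n ≡ x ℕ.* a ℕ.+ y ℕ.* (b ∸ a) → length (circuitWords x t) ≡ x C y
  length-circuitWords x t y tn≡ = ℤₚ.+-injective (begin
    + length (circuitWords x t)                            ≡⟨ ∑-𝟙 (λ w → total w ℕₚ.≟ t ℕ.* n) (words x) ⟨
    ∑ (λ w → 𝟙 (total w ℕₚ.≟ t ℕ.* n)) (words x)            ≡⟨ ∑-cong (words x) (λ {w} w∈ → 𝟙-cong (total w ℕₚ.≟ t ℕ.* n) (count w ℕₚ.≟ y) (to w (∈-words⁻ x w∈)) (from w (∈-words⁻ x w∈))) ⟩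
    ∑ (λ w → 𝟙 (count w ℕₚ.≟ y)) (words x)                  ≡⟨ ∑-count≡ x y ⟩
    + (x C y)                                              ∎)
    where
    open ≡-Reasoning
    to : ∀ w → length w ≡ x → total w ≡ t ℕ.* n → count w ≡ y
    to w refl total≡ = ℕₚ.*-cancelʳ-≡ (count w) y (b ∸ a) (ℕₚ.+-cancelˡ-≡ (x ℕ.* a) _ _
      (trans (sym (total-count w)) (trans total≡ tn≡)))
    from : ∀ w → length w ≡ x → count w ≡ y → total w ≡ t ℕ.* n
    from w refl refl = trans (total-count w) (sym tn≡)

  -- The binomial coefficients of the formula as numbers of circuits

  module _ (l : ℕ) .{{_ : NonZero l}} where

    kω⁺ : ∀ ω m y → ω ℕ.* n ≡ l ℕ.* a ℕ.+ m ℕ.* y ℕ.* (b ∸ a) →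
      + ω ℤ.* + n ℤ.- + l ℤ.* + a ≡ + m ℤ.* + y ℤ.* + (b ∸ a)
    kω⁺ ω m y eq = begin
      + ω ℤ.* + n ℤ.- + l ℤ.* + a         ≡⟨ cong₂ ℤ._-_ (ℤₚ.pos-* ω n) (ℤₚ.pos-* l a) ⟨
      + (ω ℕ.* n) ℤ.- + (l ℕ.* a)         ≡⟨ +-minus⁺ (ω ℕ.* n) (l ℕ.* a) _ eq ⟩
      + (m ℕ.* y ℕ.* (b ∸ a))             ≡⟨ trans (ℤₚ.pos-* (m ℕ.* y) (b ∸ a)) (cong (ℤ._* + (b ∸ a)) (ℤₚ.pos-* m y)) ⟩
      + m ℤ.* + y ℤ.* + (b ∸ a)           ∎
      where open ≡-Reasoning

    kω⁻ : ∀ ω m y → + ω ℤ.* + n ℤ.- + l ℤ.* + a ≡ + m ℤ.* + y ℤ.* + (b ∸ a) →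
      ω ℕ.* n ≡ l ℕ.* a ℕ.+ m ℕ.* y ℕ.* (b ∸ a)
    kω⁻ ω m y eq = +-minus⁻ (ω ℕ.* n) (l ℕ.* a) (m ℕ.* y ℕ.* (b ∸ a)) (begin
      + (ω ℕ.* n) ℤ.- + (l ℕ.* a)         ≡⟨ cong₂ ℤ._-_ (ℤₚ.pos-* ω n) (ℤₚ.pos-* l a) ⟩
      + ω ℤ.* + n ℤ.- + l ℤ.* + a         ≡⟨ eq ⟩
      + m ℤ.* + y ℤ.* + (b ∸ a)           ≡⟨ trans (ℤₚ.pos-* (m ℕ.* y) (b ∸ a)) (cong (ℤ._* + (b ∸ a)) (ℤₚ.pos-* m y)) ⟨
      + (m ℕ.* y ℕ.* (b ∸ a))             ∎)
      where open ≡-Reasoning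

    private
      factor : ∀ m x y → m ℕ.* x ℕ.* a ℕ.+ m ℕ.* y ℕ.* (b ∸ a) ≡ m ℕ.* (x ℕ.* a ℕ.+ y ℕ.* (b ∸ a))
      factor m x y = trans (cong₂ ℕ._+_ (ℕₚ.*-assoc m x a) (ℕₚ.*-assoc m y (b ∸ a))) (sym (ℕₚ.*-distribˡ-+ m (x ℕ.* a) _))

    -- If `l / m` and `kω / m` are natural numbers `x` and `y`, the `m`-th powers are the images of
    -- the circuits of length `x` and winding `ω / m`. Otherwise there are none, since a root `u`
    -- coded by `w` would make these quotients `length u` and `count w`.
    length-powers : ∀ ω m .{{_ : NonZero m}} → m ∣ ω →
      length (filter (λ c → m ∣? exponent c) (circuits l ω)) ≡
      n ℕ.* binomial ((+ l / 1) ÷ m) (kω n a b l a<b (+ ω) ÷ m)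
    length-powers ω m (divides t ω≡tm) with binomial p q | binomialView p q
      where
      p = (+ l / 1) ÷ m
      q = kω n a b l a<b (+ ω) ÷ m
    ... | _ | other ¬integral = trans (length≡0 (filter (λ c → m ∣? exponent c) (circuits l ω)) none) (sym (ℕₚ.*-zeroʳ n))
      where
      none : ∀ {c} → ¬ c ∈ filter (λ c → m ∣? exponent c) (circuits l ω)
      none {c} c∈ with ∈-filter⁻ (λ c → m ∣? exponent c) {xs = circuits l ω} c∈
      ... | c∈′ , m∣ with ∣exponent⇒power {c} m∣
      ...   | u , refl with circuits-root l ω u m c∈′ refl
      ...     | t′ , ω≡ , u∈ with ∈-circuits⁻ (length u) t′ u∈
      ...       | v , w , _ , length≡ , total≡ = ¬integral (length u , count w ,
        ÷-integral⁺ (+ l) (+ length u) 1 m (trans (cong +_ l≡) (trans (ℤₚ.pos-* m (length u)) (sym (ℤₚ.*-identityʳ _)))) ,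
        ÷-integral⁺ (+ ω ℤ.* + n ℤ.- + l ℤ.* + a) (+ count w) (b ∸ a) m (kω⁺ ω m (count w) (begin
          ω ℕ.* n                                                    ≡⟨ cong (ℕ._* n) ω≡ ⟩
          m ℕ.* t′ ℕ.* n                                             ≡⟨ ℕₚ.*-assoc m t′ n ⟩
          m ℕ.* (t′ ℕ.* n)                                           ≡⟨ cong (m ℕ.*_) total≡ ⟨
          m ℕ.* total w                                              ≡⟨ cong (m ℕ.*_) (total-count w) ⟩
          m ℕ.* (length w ℕ.* a ℕ.+ count w ℕ.* (b ∸ a))             ≡⟨ factor m (length w) (count w) ⟨
          m ℕ.* length w ℕ.* a ℕ.+ m ℕ.* count w ℕ.* (b ∸ a)         ≡⟨ cong (λ x → x ℕ.* a ℕ.+ m ℕ.* count w ℕ.* (b ∸ a)) (trans (cong (m ℕ.*_) length≡) (sym l≡)) ⟩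
          l ℕ.* a ℕ.+ m ℕ.* count w ℕ.* (b ∸ a)                      ∎)))
        where
        open ≡-Reasoning
        l≡ : l ≡ m ℕ.* length u
        l≡ = trans (sym (circuits-length l ω c∈′)) (length-power u m)
    ... | _ | integral x y p≡ q≡ = begin
      length (filter (λ c → m ∣? exponent c) (circuits l ω))
        ≡⟨ cong length (cong₂ (λ l ω → filter (λ c → m ∣? exponent c) (circuits l ω)) l≡ ω≡) ⟩
      length (filter (λ c → m ∣? exponent c) (circuits (m ℕ.* x) (m ℕ.* t)))
        ≡⟨ ↭-length (circuits-powers x t m {{ℕₚ.m*n≢0⇒n≢0 m {{subst NonZero l≡ it}}}}) ⟩
      length (map (λ u → power u m) (circuits x t))   ≡⟨ Listₚ.length-map _ (circuits x t) ⟩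
      length (circuits x t)                           ≡⟨ length-circuits x t ⟩
      n ℕ.* length (circuitWords x t)                 ≡⟨ cong (n ℕ.*_) (length-circuitWords x t y tn≡) ⟩
      n ℕ.* (x C y)                                   ∎
      where
      open ≡-Reasoning
      l≡ : l ≡ m ℕ.* x
      l≡ = ℤₚ.+-injective (trans (÷-integral⁻ (+ l) (+ x) 1 m p≡) (trans (ℤₚ.*-identityʳ _) (sym (ℤₚ.pos-* m x))))
      ω≡ : ω ≡ m ℕ.* t
      ω≡ = trans ω≡tm (ℕₚ.*-comm t m)
      tn≡ : t ℕ.* n ≡ x ℕ.* a ℕ.+ y ℕ.* (b ∸ a)
      tn≡ = ℕₚ.*-cancelˡ-≡ _ _ m (begin
        m ℕ.* (t ℕ.* n)                              ≡⟨ ℕₚ.*-assoc m t n ⟨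
        m ℕ.* t ℕ.* n                                ≡⟨ cong (ℕ._* n) ω≡ ⟨
        ω ℕ.* n                                      ≡⟨ kω⁻ ω m y (÷-integral⁻ (+ ω ℤ.* + n ℤ.- + l ℤ.* + a) (+ y) (b ∸ a) m q≡) ⟩
        l ℕ.* a ℕ.+ m ℕ.* y ℕ.* (b ∸ a)              ≡⟨ cong (λ l → l ℕ.* a ℕ.+ m ℕ.* y ℕ.* (b ∸ a)) l≡ ⟩
        m ℕ.* x ℕ.* a ℕ.+ m ℕ.* y ℕ.* (b ∸ a)        ≡⟨ factor m x y ⟩
        m ℕ.* (x ℕ.* a ℕ.+ y ℕ.* (b ∸ a))            ∎)

  -- Periodic orbits and primitivity in terms of rotations

  σ≡rotate : ∀ c → σ c ≡ rotate c
  σ≡rotate []      = refl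
  σ≡rotate (_ ∷ _) = refl

  ≈⇒∼ : ∀ {c c′} → c ≈ c′ → c ∼ c′
  ≈⇒∼ = EqClosure.fold ∼-isEquivalence λ { {c} refl → 1 , sym (σ≡rotate c) }

  rotate^⇒≈ : ∀ d {c c′} → rotate^ d c ≡ c′ → c ≈ c′
  rotate^⇒≈ zero    refl = EqClosure.reflexive _↻_
  rotate^⇒≈ (suc d) {c} eq = EqClosure.transitive _↻_ (EqClosure.return (σ≡rotate c)) (rotate^⇒≈ d eq)

  -- If `c` is a rotation of `c₀ ^ r`, that power has exponent 1 too, and `r` divides it.
  exponent≡1⇒primitive : ∀ {c} → exponent c ≡ 1 → IsPrimitive c
  exponent≡1⇒primitive {c} g≡1 (c₀ , r , _ , 1<r , c≈) = ℕₚ.<⇒≢ 1<r (sym (∣1⇒≡1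
    (subst (r ∣_) (trans (exponent-∼ (≈⇒∼ c≈)) g≡1) (power⇒∣exponent {c₀ ^ r} {c₀} {r} refl))))

  -- lower and upper stand for ⌈la/n⌉ and ⌊lb/n⌋, of which only these properties matter.
  module Count (l : ℕ) .{{_ : NonZero l}} (0<a : 0 < a) (lower upper : ℤ)
    (lower≤⁺ : ∀ ω → + (l ℕ.* a) ℤ.≤ ω ℤ.* + n → lower ℤ.≤ ω)
    (lower≤⁻ : ∀ ω → lower ℤ.≤ ω → + (l ℕ.* a) ℤ.≤ ω ℤ.* + n)
    (≤upper : ∀ ω → ω ℤ.* + n ℤ.≤ + (l ℕ.* b) → ω ℤ.≤ upper)
    where

    exponent>0 : ∀ ω {c} → c ∈ circuits l ω → NonZero (exponent c)
    exponent>0 ω {c} c∈ = exponent≢0 {c} {{subst NonZero (sym (circuits-length l ω c∈)) it}}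

    -- An exponent `g ≥ 2` would itself serve as `r`: the `g`-th root is a circuit by
    -- `circuits-root`, as the definition of primitivity demands.
    primitive⇒exponent≡1 : ∀ ω {c} → c ∈ circuits l ω → IsPrimitive c → exponent c ≡ 1
    primitive⇒exponent≡1 ω {c} c∈ c-primitive = cases (exponent c) refl {{exponent>0 ω c∈}}
      where
      cases : ∀ g → exponent c ≡ g → .{{_ : NonZero g}} → g ≡ 1
      cases (suc zero)        _  = refl
      cases g@(suc (suc g-2)) g≡ =
        let u , c≡      = ∣exponent⇒power {c} (∣-reflexive (sym g≡))
            t , _ , u∈  = circuits-root l ω u g c∈ c≡
        in contradiction (u , g , circuits-isCircuit (length u) t u∈ , ℕ.s<s z<s , rotate^⇒≈ 0 c≡) c-primitive

    windings : List ℕ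
    windings = map ℤ.∣_∣ (interval lower upper)

    -- `ω * n ≥ l * a > 0`. Positivity makes absolute values injective on the range and gives
    -- `∑-divisors` its intended meaning, as its list is empty at 0.
    winding-positive : ∀ {ω} → ω ∈ interval lower upper → ∃[ k ] ω ≡ + suc k
    winding-positive {ω} ω∈ = positive ω (ℤₚ.*-cancelʳ-<-nonNeg (+ n) (ℤₚ.<-≤-trans
      (ℤ.+<+ (ℕₚ.*-mono-< (ℕ.>-nonZero⁻¹ l) 0<a))
      (lower≤⁻ ω (interval-lower lower upper ω∈))))
      where
      positive : ∀ ω → 0ℤ ℤ.< ω → ∃[ k ] ω ≡ + suc k
      positive (+ suc k) _ = k , refl
      positive (+ zero) (ℤ.+<+ ())

    windings! : Unique windings
    windings! = unique-map abs-injective (interval! lower upper)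
      where
      abs-injective : ∀ {ω ω′} → ω ∈ interval lower upper → ω′ ∈ interval lower upper → ℤ.∣ ω ∣ ≡ ℤ.∣ ω′ ∣ → ω ≡ ω′
      abs-injective ω∈ ω′∈ eq with winding-positive ω∈ | winding-positive ω′∈
      ... | _ , refl | _ , refl = cong +_ eq

    allCircuits : List (List VertexPair)
    allCircuits = concat (map (circuits l) windings)

    allCircuits! : Unique allCircuits
    allCircuits! = Unique.concat⁺ (Allₚ.map⁺ (All.universal (λ ω → circuits! l ω) windings))
      (AllPairsₚ.map⁺ (AllPairs.map disjoint windings!))
      where
      disjoint : ∀ {ω ω′} → ω ≢ ω′ → Disjoint (circuits l ω) (circuits l ω′)
      disjoint {ω} {ω′} ω≢ω′ (c∈ , c∈′) with ∈-circuits⁻ l ω c∈ | ∈-circuits⁻ l ω′ c∈′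
      ... | v , w , c≡ , _ , total≡ | v′ , w′ , c≡′ , _ , total≡′ = ω≢ω′ (ℕₚ.*-cancelʳ-≡ ω ω′ n
        (trans (sym total≡) (trans (cong total (path-injective (trans (sym c≡) c≡′))) total≡′)))

    ∈-allCircuits⁻ : ∀ {c} → c ∈ allCircuits → ∃[ ω ] ω ∈ windings × c ∈ circuits l ω
    ∈-allCircuits⁻ c∈ with ∈-concat⁻′ (map (circuits l) windings) c∈
    ... | _ , c∈′ , cs∈ with ∈-map⁻ (circuits l) cs∈
    ...   | ω , ω∈ , refl = ω , ω∈ , c∈′

    ∈-allCircuits⁺ : ∀ {ω c} → ω ∈ windings → c ∈ circuits l ω → c ∈ allCircuits
    ∈-allCircuits⁺ ω∈ c∈ = ∈-concat⁺′ c∈ (∈-map⁺ (circuits l) ω∈)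

    -- The range of summation misses no circuit: `ω * n` is the total of a word of length `l`, hence
    -- between `l * a` and `l * b`.
    circuit∈ : ∀ {c} → IsCircuit c → length c ≡ l → c ∈ allCircuits
    circuit∈ c-circuit length≡ with circuit⇒path c-circuit (λ { refl → ℕ.≢-nonZero⁻¹ l (sym length≡) })
    ... | v , w , refl , divides ω total≡ = ∈-allCircuits⁺ (∈-map⁺ ℤ.∣_∣ (∈-interval lower upper
        (lower≤⁺ (+ ω) (subst (+ (l ℕ.* a) ℤ.≤_) total≡ℤ (ℤ.+≤+ (subst (λ x → x ℕ.* a ≤ total w) length-w (total≥ w)))))
        (≤upper (+ ω) (subst (ℤ._≤ + (l ℕ.* b)) total≡ℤ (ℤ.+≤+ (subst (λ x → total w ≤ x ℕ.* b) length-w (total≤ w)))))))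
      (∈-circuits⁺ l ω v length-w total≡)
      where
      length-w : length w ≡ l
      length-w = trans (sym (length-path v w)) length≡
      total≡ℤ : + total w ≡ + ω ℤ.* + n
      total≡ℤ = trans (cong +_ total≡) (ℤₚ.pos-* ω n)

    exponent≡1? : (c : List VertexPair) → Dec (exponent c ≡ 1)
    exponent≡1? c = exponent c ℕₚ.≟ 1

    primitives : List (List VertexPair)
    primitives = filter exponent≡1? allCircuits

    ∈-primitives⁻ : ∀ {c} → c ∈ primitives → c ∈ allCircuits × exponent c ≡ 1
    ∈-primitives⁻ = ∈-filter⁻ exponent≡1? {xs = allCircuits}

    primitives-length : ∀ {c} → c ∈ primitives → length c ≡ l
    primitives-length c∈ with ∈-allCircuits⁻ (proj₁ (∈-primitives⁻ c∈))
    ... | ω , _ , c∈′ = circuits-length l ω c∈′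

    primitives-rotate : ∀ {c} → c ∈ primitives → rotate c ∈ primitives
    primitives-rotate {c} c∈ with ∈-primitives⁻ c∈
    ... | c∈′ , g≡1 with ∈-allCircuits⁻ c∈′
    ...   | ω , ω∈ , c∈ω = ∈-filter⁺ exponent≡1? (∈-allCircuits⁺ ω∈ (circuits-rotate l ω c∈ω))
      (trans (exponent-∼ {c} (1 , refl)) g≡1)

    open Orbits l primitives (Unique.filter⁺ exponent≡1? allCircuits!)
      primitives-length (proj₂ ∘ ∈-primitives⁻) primitives-rotate

    primitive∈ : (c : PrimitiveCircuit l) → PrimitiveCircuit.bonds c ∈ primitives
    primitive∈ c with ∈-allCircuits⁻ c∈
      where
      c∈ = circuit∈ (PrimitiveCircuit.isCircuit c) (PrimitiveCircuit.length≡ c)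
    ... | ω , ω∈ , c∈ω = ∈-filter⁺ exponent≡1? (∈-allCircuits⁺ ω∈ c∈ω)
      (primitive⇒exponent≡1 ω c∈ω (PrimitiveCircuit.isPrimitive c))

    primitiveCircuit : ∀ {c} → c ∈ primitives → PrimitiveCircuit l
    primitiveCircuit {c} c∈ = record
      { bonds       = c
      ; length≡     = primitives-length c∈
      ; isCircuit   = let ω , _ , c∈ω = ∈-allCircuits⁻ (proj₁ (∈-primitives⁻ c∈)) in circuits-isCircuit l ω c∈ω
      ; isPrimitive = exponent≡1⇒primitive (proj₂ (∈-primitives⁻ c∈))
      }

    orbitCount : ℕ
    orbitCount = length representatives

    orbits-cardinality : HasCardinality (PrimitiveOrbits n a b l) orbitCount
    orbits-cardinality = record
      { to        = index
      ; cong      = λ {c} {c′} c≈c′ → index-unique representatives≁ (rep c) (index c′)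
                      (∼.trans (≈⇒∼ c≈c′) (Anyₚ.lookup-index (rep c′)))
      ; bijective = (λ {c} {c′} eq →
                      let d , rot≡ = ∼.trans (Anyₚ.lookup-index (rep c))
                            (∼.sym (subst (λ i → _ ∼ lookup representatives i) (sym eq) (Anyₚ.lookup-index (rep c′))))
                      in rotate^⇒≈ d rot≡)
                  -- Surjectivity asks that every circuit equivalent to the chosen preimage has
                  -- index `i`, which `index-unique` supplies.
                  , λ i → primitiveCircuit (representative∈ (∈-lookup i)) ,
                      λ {c} c≈ → index-unique representatives≁ (rep c) i (≈⇒∼ c≈)
      }
      where
      rep : (c : PrimitiveCircuit l) → Any (PrimitiveCircuit.bonds c ∼_) representatives
      rep c = representative (primitive∈ c)
      index : PrimitiveCircuit l → Fin orbitCount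
      index c = Any.index (rep c)

    term : ℤ → (m : ℕ) .{{_ : NonZero m}} → ℤ
    term ω m = μ m ℤ.* + binomial ((+ l / 1) ÷ m) (kω n a b l a<b ω ÷ m)

    ∑-primitive-circuits : ∀ ω .{{_ : NonZero ω}} →
      ∑ (λ c → 𝟙 (exponent≡1? c)) (circuits l ω) ≡ + n ℤ.* ∑-divisors (+ ω) (term (+ ω))
    ∑-primitive-circuits ω = begin
      ∑ (λ c → 𝟙 (exponent≡1? c)) (circuits l ω)
        ≡⟨ ∑-cong (circuits l ω) expand ⟩
      ∑ (λ c → ∑ (λ i → μ⁺ i ℤ.* 𝟙 (suc i ∣? exponent c)) (divisors ω)) (circuits l ω)
        ≡⟨ ∑-swap (λ c i → μ⁺ i ℤ.* 𝟙 (suc i ∣? exponent c)) (circuits l ω) (divisors ω) ⟩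
      ∑ (λ i → ∑ (λ c → μ⁺ i ℤ.* 𝟙 (suc i ∣? exponent c)) (circuits l ω)) (divisors ω)
        ≡⟨ ∑-cong (divisors ω) (λ {i} i∈ → count-powers i (∈-divisors⁻ ω i∈)) ⟩
      ∑ (λ i → + n ℤ.* term (+ ω) (suc i)) (divisors ω)
        ≡⟨ ∑-*ˡ (+ n) (λ i → term (+ ω) (suc i)) (divisors ω) ⟩
      + n ℤ.* ∑ (λ i → term (+ ω) (suc i)) (divisors ω)
        ∎
      where
      open ≡-Reasoning
      -- Since the exponent divides `ω`, its divisors can be picked out of those of `ω`. The index
      -- list then no longer depends on `c`, as exchanging the sums requires.
      expand : ∀ {c} → c ∈ circuits l ω →
        𝟙 (exponent≡1? c) ≡ ∑ (λ i → μ⁺ i ℤ.* 𝟙 (suc i ∣? exponent c)) (divisors ω)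
      expand {c} c∈ = begin
        𝟙 (exponent≡1? c)                                              ≡⟨ ∑-μ-divisors g ⟨
        ∑ μ⁺ (divisors g)                                              ≡⟨ ∑-↭ μ⁺ (unique∧⊆⊇⇒↭ (divisors! g) (Unique.filter⁺ div? (divisors! ω)) to from) ⟩
        ∑ μ⁺ (filter div? (divisors ω))                                ≡⟨ ∑-filter div? μ⁺ (divisors ω) ⟩
        ∑ (λ i → μ⁺ i ℤ.* 𝟙 (suc i ∣? g)) (divisors ω)                  ∎
        where
        g = exponent c
        instance
          g≢0 : NonZero g
          g≢0 = exponent>0 ω c∈
        div? : (i : ℕ) → Dec (suc i ∣ g)
        div? i = suc i ∣? g
        to : ∀ {i} → i ∈ divisors g → i ∈ filter div? (divisors ω)
        to i∈ = ∈-filter⁺ div? (∈-divisors⁺ ω (∣-trans (∈-divisors⁻ g i∈) (exponent∣winding l ω c∈))) (∈-divisors⁻ g i∈)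
        from : ∀ {i} → i ∈ filter div? (divisors ω) → i ∈ divisors g
        from i∈ = ∈-divisors⁺ g (proj₂ (∈-filter⁻ div? {xs = divisors ω} i∈))
      count-powers : ∀ i → suc i ∣ ω → ∑ (λ c → μ⁺ i ℤ.* 𝟙 (suc i ∣? exponent c)) (circuits l ω) ≡ + n ℤ.* term (+ ω) (suc i)
      count-powers i i∣ω = begin
        ∑ (λ c → μ⁺ i ℤ.* 𝟙 (suc i ∣? exponent c)) (circuits l ω)
          ≡⟨ ∑-*ˡ (μ⁺ i) (λ c → 𝟙 (suc i ∣? exponent c)) (circuits l ω) ⟩
        μ⁺ i ℤ.* ∑ (λ c → 𝟙 (suc i ∣? exponent c)) (circuits l ω)
          ≡⟨ cong (μ⁺ i ℤ.*_) (∑-𝟙 (λ c → suc i ∣? exponent c) (circuits l ω)) ⟩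
        μ⁺ i ℤ.* + length (filter (λ c → suc i ∣? exponent c) (circuits l ω))
          ≡⟨ cong (λ k → μ⁺ i ℤ.* + k) (length-powers l ω (suc i) i∣ω) ⟩
        μ⁺ i ℤ.* + (n ℕ.* k)         ≡⟨ cong (μ⁺ i ℤ.*_) (ℤₚ.pos-* n k) ⟩
        μ⁺ i ℤ.* (+ n ℤ.* + k)       ≡⟨ ℤ*.x∙yz≈y∙xz (μ⁺ i) (+ n) (+ k) ⟩
        + n ℤ.* (μ⁺ i ℤ.* + k)       ∎
        where
        k = binomial ((+ l / 1) ÷ suc i) (kω n a b l a<b (+ ω) ÷ suc i)

    formula : ℤ
    formula = ∑[ ω from lower to upper ] ∑-divisors ω (term ω)

    orbitCount*l : + (orbitCount ℕ.* l) ≡ + n ℤ.* formula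
    orbitCount*l = begin
      + (orbitCount ℕ.* l)                                                 ≡⟨ cong +_ length-orbits ⟨
      + length primitives                                                  ≡⟨ ∑-𝟙 exponent≡1? allCircuits ⟨
      ∑ (λ c → 𝟙 (exponent≡1? c)) allCircuits                              ≡⟨ ∑-concat _ (map (circuits l) windings) ⟩
      ∑ (∑ (λ c → 𝟙 (exponent≡1? c))) (map (circuits l) windings)          ≡⟨ ∑-map _ (circuits l) windings ⟩
      ∑ (λ ω → ∑ (λ c → 𝟙 (exponent≡1? c)) (circuits l ω)) windings        ≡⟨ ∑-map _ ℤ.∣_∣ (interval lower upper) ⟩
      ∑ (λ ω → ∑ (λ c → 𝟙 (exponent≡1? c)) (circuits l ℤ.∣ ω ∣)) (interval lower upper)
                                                                           ≡⟨ ∑-cong (interval lower upper) per-winding ⟩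
      ∑ (λ ω → + n ℤ.* ∑-divisors ω (term ω)) (interval lower upper)       ≡⟨ ∑-*ˡ (+ n) _ (interval lower upper) ⟩
      + n ℤ.* formula                                                      ∎
      where
      open ≡-Reasoning
      per-winding : ∀ {ω} → ω ∈ interval lower upper →
        ∑ (λ c → 𝟙 (exponent≡1? c)) (circuits l ℤ.∣ ω ∣) ≡ + n ℤ.* ∑-divisors ω (term ω)
      per-winding ω∈ with winding-positive ω∈
      ... | k , refl = ∑-primitive-circuits (suc k)

    orbitCount≡ : + orbitCount / 1 ≡ (+ n / l) ℚ.* (formula / 1)
    orbitCount≡ = sym (trans (/-* (+ n) formula l 1) (/-≡⁺ (+ n ℤ.* formula) (+ orbitCount) (l ℕ.* 1) 1 {{ℕₚ.m*n≢0 l 1}} (begin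
      + n ℤ.* formula ℤ.* + 1          ≡⟨ ℤₚ.*-identityʳ _ ⟩
      + n ℤ.* formula                  ≡⟨ orbitCount*l ⟨
      + (orbitCount ℕ.* l)             ≡⟨ ℤₚ.pos-* orbitCount l ⟩
      + orbitCount ℤ.* + l             ≡⟨ cong (λ k → + orbitCount ℤ.* + k) (ℕₚ.*-identityʳ l) ⟨
      + orbitCount ℤ.* + (l ℕ.* 1)     ∎)))
      where open ≡-Reasoning

theorem2 : (n a b l : ℕ) .{{_ : NonZero n}} .{{_ : NonZero l}} →
    2 ≤ n → 0 < a → (a<b : a < b) → b < n → Connected n a b →
    ∃[ N ] HasCardinality (PrimitiveOrbits n a b l) N ×
    + N / 1 ≡ (+ n / l) ℚ.*
    ((∑[ ω from ceiling (+ (l ℕ.* a) / n) to floor (+ (l ℕ.* b) / n) ]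
    ∑-divisors ω (λ m → μ m ℤ.* + binomial ((+ l / 1) ÷ m) (kω n a b l a<b ω ÷ m))) / 1)
theorem2 n a b l _ 0<a a<b b<n _ = orbitCount , orbits-cardinality , orbitCount≡
  where
  open Winding n a b a<b b<n
  open Count l 0<a (ceiling (+ (l ℕ.* a) / n)) (floor (+ (l ℕ.* b) / n))
    (ceiling≤⁺ (+ (l ℕ.* a)) n) (ceiling≤⁻ (+ (l ℕ.* a)) n) (≤floor (+ (l ℕ.* b)) n)
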